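{- Let $l\ge 2$ and let $L_{rel}$, $\mathbf{C}_n$, $\mathbf{S}_n$ and the $L_{rel}$-formula $\xi(y,z)$ be as in the context. Let $f:\mathbb{N}\to\mathbb{R}$ be such that $\lim_{n\to\infty}f(n)/\ln n=\infty$. Suppose that the proportion of $\mathcal{M}\in\mathbf{C}_n$ which have an $f(n)$-rich $l$-colouring approaches $1$ as $n\to\infty$. Then the proportion of $\mathcal{M}\in\mathbf{C}_n$ such that every $l$-colouring $\gamma$ of $\mathcal{M}$ is definable by $\xi(y,z)$, in the sense that for all $a,b\in M$, $\mathcal{M}\models\xi(a,b)\Leftrightarrow\gamma(a)=\gamma(b)$, approaches $1$ as $n\to\infty$. Consequently, the proportion of $\mathcal{M}\in\mathbf{C}_n$ which have a unique $l$-colouring, up to permutation of colours, approaches $1$ as $n\to\infty$. If every relation symbol of $L_{rel}$ has arity at most $l$, the same statements hold if $\mathbf{C}_n$ is replaced by $\mathbf{S}_n$ and $l$-colourings by strong $l$-colourings (in which case the formula $\xi(y,z)$ may be different).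
   Context: $l\ge2$ is a fixed integer. $L_{rel}$ is a first-order language with finite nonempty relational vocabulary, all symbols of arity at least $2$. An $l$-colouring of an $L_{rel}$-structure $\mathcal{M}$ is a function $\gamma:M\to\{1,\ldots,l\}$ such that whenever $R$ is a relation symbol and $(a_1,\ldots,a_m)\in R^{\mathcal{M}}$, there are $i,j$ with $\gamma(a_i)\ne\gamma(a_j)$; it is a strong $l$-colouring if whenever $(a_1,\ldots,a_m)\in R^{\mathcal{M}}$, $\gamma(a_i)\neq\gamma(a_j)$ for all $i\ne j$. $\mathcal{M}$ is (strongly) $l$-colourable if it has a (strong) $l$-colouring. $\gamma$ is $m$-rich ($m\in\mathbb{R}$) if $|\gamma^{ -1}(i)|\ge m$ for all $i\in\{1,\ldots,l\}$. $\mathbf{C}_n$ (respectively $\mathbf{S}_n$) is the set of all $l$-colourable (respectively strongly $l$-colourable) $L_{rel}$-structures with universe $\{1,\ldots,n\}$. Proportions refer to the uniform probability measure. The formula $\xi$: fix an $l$-colourable (in the strong case: strongly $l$-colourable) $L_{rel}$-structure $\mathcal{S}$ with universe $\{1,\ldots,s\}$, $s\ge3$, such that every (strong) $l$-colouring of $\mathcal{S}$ gives $s-1$ and $s$ the same colour, and for every $i\in\{1,\ldots,l\}$ there is a (strong) $l$-colouring of $\mathcal{S}$ giving both $s-1$ and $s$ the colour $i$ (such $\mathcal{S}$ exists). Let $\chi_{\mathcal{S}}(x_1,\ldots,x_s)$ be a quantifier-free $L_{rel}$-formula such that $\mathcal{M}\models\chi_{\mathcal{S}}(a_1,\ldots,a_s)$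 iff $a_i\mapsto i$ is an isomorphism from $\mathcal{M}\upharpoonright\{a_1,\ldots,a_s\}$ to $\mathcal{S}$. Then $\xi(y,z)$ is the formula $y=z\vee\exists u_1,\ldots,u_{s-2}\,\chi_{\mathcal{S}}(u_1,\ldots,u_{s-2},y,z)$. -}

module Defs where

open import Data.Bool.Base using (Bool; true)
open import Data.Empty using (⊥)
open import Data.Fin.Base using (Fin; zero; suc; _↑ʳ_)
import Data.Fin.Properties as Fin
open import Data.Fin.Permutation using (Permutation′; _⟨$⟩ʳ_)
open import Data.Integer.Base using (+_; +[1+_])
import Data.Integer.Base as ℤ
import Data.Integer.Properties as ℤ
open import Data.List.Base using (List; length)
open import Data.List.Relation.Unary.All using (All)
import Data.List.Membership.Setoid as Membership
import Data.List.Relation.Unary.Unique.Setoid as Unique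
open import Data.Nat.Base using (ℕ; zero; suc; NonZero; _∸_)
import Data.Nat.Base as ℕ
import Data.Nat.Properties as ℕ
open import Data.Product.Base using (Σ; ∃; ∃₂; _×_; _,_)
open import Data.Rational.Base
  using (ℚ; mkℚ; _/_; 0ℚ; 1ℚ; _+_; _*_; _-_; -_; 1/_; _<_; _≤_; toℚᵘ; Positive; *<*)
open import Data.Rational.Properties
import Data.Rational.Unnormalised.Base as ℚᵘ
import Data.Rational.Unnormalised.Properties as ℚᵘ
open import Data.Rational.Solver using (module +-*-Solver)
open import Data.Sum.Base using (_⊎_; inj₁; inj₂)
open import Data.Vec.Base using (Vec; []; _∷_; lookup; map; count; allFin)
open import Function.Bundles using (_⇔_; mk⇔; module Equivalence)
open import Function.Definitions using (Injective)
open import Relation.Binary.Bundles using (Setoid)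
open import Relation.Binary.PropositionalEquality
open import Relation.Nullary using (¬_; yes; no)

------------------------------------------------------------------------
-- Real numbers

-- Dedekind reals: `lower q` is q < x and `upper q` is x < q.
record ℝ : Set₁ where
  field
    lower upper     : ℚ → Set
    lower-inhabited : ∃ lower
    upper-inhabited : ∃ upper
    lower-rounded   : ∀ q → lower q ⇔ (∃ λ r → q < r × lower r)
    upper-rounded   : ∀ q → upper q ⇔ (∃ λ r → r < q × upper r)
    disjoint        : ∀ q → ¬ (lower q × upper q)
    located         : ∀ {q r} → q < r → lower q ⊎ upper r

open ℝ public

infix 4 _≤ᴿ_ _<ᴿ_

_≤ᴿ_ : ℝ → ℝ → Set
x ≤ᴿ y = ∀ q → lower x q → lower y q

_<ᴿ_ : ℝ → ℝ → Set
x <ᴿ y = ∃ λ q → upper x q × lower y q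

ℕ⇒ℚ : ℕ → ℚ
ℕ⇒ℚ n = + n / 1

private
  q-1<q : ∀ q → q - 1ℚ < q
  q-1<q q = subst (q - 1ℚ <_) (+-identityʳ q) (+-monoʳ-< q (negative⁻¹ (- 1ℚ)))

  q<q+1 : ∀ q → q < q + 1ℚ
  q<q+1 q = subst (_< q + 1ℚ) (+-identityʳ q) (+-monoʳ-< q (positive⁻¹ 1ℚ))

ℚ⇒ℝ : ℚ → ℝ
ℚ⇒ℝ p = record
  { lower           = _< p
  ; upper           = p <_
  ; lower-inhabited = p - 1ℚ , q-1<q p
  ; upper-inhabited = p + 1ℚ , q<q+1 p
  ; lower-rounded   = λ q → mk⇔ <-dense (λ (r , q<r , r<p) → <-trans q<r r<p)
  ; upper-rounded   = λ q → mk⇔ (λ p<q → let (r , p<r , r<q) = <-dense p<q in r , r<q , p<r)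
                                (λ (r , r<q , p<r) → <-trans p<r r<q)
  ; disjoint        = λ q (q<p , p<q) → <-asym q<p p<q
  ; located         = loc
  }
  where
  loc : ∀ {q r} → q < r → q < p ⊎ p < r
  loc {q} {r} q<r with q <? p
  ... | yes q<p = inj₁ q<p
  ... | no  q≮p = inj₂ (≤-<-trans (≮⇒≥ q≮p) q<r)

infixl 7 _·_

_·_ : (K : ℚ) .{{_ : Positive K}} → ℝ → ℝ
K · x = record
  { lower           = λ q → lower x (K⁻¹ * q)
  ; upper           = λ q → upper x (K⁻¹ * q)
  ; lower-inhabited = let (q , l) = lower-inhabited x in K * q , subst (lower x) (sym (cancel q)) l
  ; upper-inhabited = let (q , u) = upper-inhabited x in K * q , subst (upper x) (sym (cancel q)) u
  ; lower-rounded   = λ q → mk⇔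
      (λ l → let (r , lt , lr) = Equivalence.to (lower-rounded x _) l
             in K * r , subst (_< K * r) (cancel′ q) (*-monoʳ-<-pos K lt)
              , subst (lower x) (sym (cancel r)) lr)
      (λ (r , lt , lr) → Equivalence.from (lower-rounded x _) (K⁻¹ * r , *-monoʳ-<-pos K⁻¹ lt , lr))
  ; upper-rounded   = λ q → mk⇔
      (λ u → let (r , lt , ur) = Equivalence.to (upper-rounded x _) u
             in K * r , subst (K * r <_) (cancel′ q) (*-monoʳ-<-pos K lt)
              , subst (upper x) (sym (cancel r)) ur)
      (λ (r , lt , ur) → Equivalence.from (upper-rounded x _) (K⁻¹ * r , *-monoʳ-<-pos K⁻¹ lt , ur))
  ; disjoint        = λ q → disjoint x (K⁻¹ * q)
  ; located         = λ q<r → located x (*-monoʳ-<-pos K⁻¹ q<r)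
  }
  where
  instance
    _ = pos⇒nonZero K
  K⁻¹ : ℚ
  K⁻¹ = 1/ K
  instance
    _ = 1/pos⇒pos K
  cancel : ∀ q → K⁻¹ * (K * q) ≡ q
  cancel q = trans (sym (*-assoc K⁻¹ K q)) (trans (cong (_* q) (*-inverseˡ K)) (*-identityˡ q))
  cancel′ : ∀ q → K * (K⁻¹ * q) ≡ q
  cancel′ q = trans (sym (*-assoc K K⁻¹ q)) (trans (cong (_* q) (*-inverseʳ K)) (*-identityˡ q))

------------------------------------------------------------------------
-- The natural logarithm

∑ : ℕ → (ℕ → ℚ) → ℚ
∑ zero    g = 0ℚ
∑ (suc m) g = ∑ m g + g m

-- The value at 0 is junk and is never used in ln n for n ≥ 1.
recip : ℕ → ℚ
recip zero    = 0ℚ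
recip (suc k) = + 1 / suc k

-- The lower and upper Riemann sums of ∫₁ⁿ dt/t for the partition of [1,n]
-- into intervals of length 1/N: on [1 + i/N , 1 + (i+1)/N] the contribution is
-- (1/N)·1/(1 + (i+1)/N) = 1/(N+i+1), respectively (1/N)·1/(1 + i/N) = 1/(N+i).
lowerSum upperSum : ℕ → ℕ → ℚ
lowerSum n N = ∑ ((n ∸ 1) ℕ.* N) (λ i → recip (suc (N ℕ.+ i)))
upperSum n N = ∑ ((n ∸ 1) ℕ.* N) (λ i → recip (N ℕ.+ i))

private
  ∑-mono : ∀ m {g h} → (∀ i → g i ≤ h i) → ∑ m g ≤ ∑ m h
  ∑-mono zero    g≤h = ≤-refl
  ∑-mono (suc m) g≤h = +-mono-≤ (∑-mono m g≤h) (g≤h m)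

  ∑-cong : ∀ m {g h} → (∀ i → g i ≡ h i) → ∑ m g ≡ ∑ m h
  ∑-cong zero    g≡h = refl
  ∑-cong (suc m) g≡h = cong₂ _+_ (∑-cong m g≡h) (g≡h m)

  ∑-mono-< : ∀ m {g h} → (∀ i → i ℕ.< m → g i ≤ h i) → ∑ m g ≤ ∑ m h
  ∑-mono-< zero    g≤h = ≤-refl
  ∑-mono-< (suc m) g≤h =
    +-mono-≤ (∑-mono-< m (λ i i<m → g≤h i (ℕ.m<n⇒m<1+n i<m))) (g≤h m (ℕ.n<1+n m))

  ∑-++ : ∀ a b g → ∑ (a ℕ.+ b) g ≡ ∑ a g + ∑ b (λ i → g (a ℕ.+ i))
  ∑-++ a zero    g rewrite ℕ.+-identityʳ a = sym (+-identityʳ _)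
  ∑-++ a (suc b) g rewrite ℕ.+-suc a b =
    trans (cong (_+ g (a ℕ.+ b)) (∑-++ a b g)) (+-assoc (∑ a g) _ _)

  ∑-blocks : ∀ a M g → ∑ (a ℕ.* M) g ≡ ∑ a (λ i → ∑ M (λ j → g (i ℕ.* M ℕ.+ j)))
  ∑-blocks zero    M g = refl
  ∑-blocks (suc a) M g = trans (cong (λ m → ∑ m g) (ℕ.+-comm M (a ℕ.* M)))
    (trans (∑-++ (a ℕ.* M) M g)
      (cong (_+ ∑ M (λ j → g (a ℕ.* M ℕ.+ j))) (∑-blocks a M g)))

  ℕ⇒ℚ-suc : ∀ m → ℕ⇒ℚ (suc m) ≡ ℕ⇒ℚ m + 1ℚ
  ℕ⇒ℚ-suc m = toℚᵘ-injective (begin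
    toℚᵘ (ℕ⇒ℚ (suc m))              ≈⟨ toℚᵘ-fromℚᵘ (ℚᵘ.mkℚᵘ (+ suc m) 0) ⟩
    ℚᵘ.mkℚᵘ (+ suc m) 0             ≈⟨ ℚᵘ.*≡* eq ⟩
    ℚᵘ.mkℚᵘ (+ m) 0 ℚᵘ.+ ℚᵘ.1ℚᵘ     ≈⟨ ℚᵘ.+-congˡ ℚᵘ.1ℚᵘ (toℚᵘ-fromℚᵘ (ℚᵘ.mkℚᵘ (+ m) 0)) ⟨
    toℚᵘ (ℕ⇒ℚ m) ℚᵘ.+ toℚᵘ 1ℚ       ≈⟨ toℚᵘ-homo-+ (ℕ⇒ℚ m) 1ℚ ⟨
    toℚᵘ (ℕ⇒ℚ m + 1ℚ)               ∎)
    where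
    open ℚᵘ.≃-Reasoning
    eq : + suc m ℤ.* + 1 ≡ (+ m ℤ.* + 1 ℤ.+ + 1) ℤ.* + 1
    eq = cong (ℤ._* + 1) (trans (cong +_ (ℕ.+-comm 1 m)) (cong (ℤ._+ + 1) (sym (ℤ.*-identityʳ (+ m)))))

  ∑-const : ∀ m c → ∑ m (λ _ → c) ≡ ℕ⇒ℚ m * c
  ∑-const zero    c = sym (*-zeroˡ c)
  ∑-const (suc m) c = begin
    ∑ m (λ _ → c) + c       ≡⟨ cong₂ _+_ (∑-const m c) (sym (*-identityˡ c)) ⟩
    ℕ⇒ℚ m * c + 1ℚ * c      ≡⟨ *-distribʳ-+ c (ℕ⇒ℚ m) 1ℚ ⟨
    (ℕ⇒ℚ m + 1ℚ) * c        ≡⟨ cong (_* c) (ℕ⇒ℚ-suc m) ⟨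
    ℕ⇒ℚ (suc m) * c         ∎
    where open ≡-Reasoning

  toℚᵘ-recip : ∀ k → toℚᵘ (recip (suc k)) ℚᵘ.≃ ℚᵘ.mkℚᵘ (+ 1) k
  toℚᵘ-recip k = toℚᵘ-fromℚᵘ (ℚᵘ.mkℚᵘ (+ 1) k)

  recip-antitone : ∀ {a b} .{{_ : NonZero a}} → a ℕ.≤ b → recip b ≤ recip a
  recip-antitone {suc a} {suc b} a≤b = toℚᵘ-cancel-≤ (begin
    toℚᵘ (recip (suc b))  ≃⟨ toℚᵘ-recip b ⟩
    ℚᵘ.mkℚᵘ (+ 1) b       ≤⟨ ℚᵘ.*≤* (ℤ.*-monoˡ-≤-nonNeg (+ 1) (ℤ.+≤+ a≤b)) ⟩
    ℚᵘ.mkℚᵘ (+ 1) a       ≃⟨ toℚᵘ-recip a ⟨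
    toℚᵘ (recip (suc a))  ∎)
    where open ℚᵘ.≤-Reasoning

  recip-scale : ∀ M k .{{_ : NonZero M}} .{{_ : NonZero k}} → ℕ⇒ℚ M * recip (M ℕ.* k) ≡ recip k
  recip-scale M@(suc m) k@(suc k′) = toℚᵘ-injective (begin
    toℚᵘ (ℕ⇒ℚ M * recip (M ℕ.* k))                          ≈⟨ toℚᵘ-homo-* (ℕ⇒ℚ M) (recip (M ℕ.* k)) ⟩
    toℚᵘ (ℕ⇒ℚ M) ℚᵘ.* toℚᵘ (recip (M ℕ.* k))                ≈⟨ ℚᵘ.*-cong (toℚᵘ-fromℚᵘ (ℚᵘ.mkℚᵘ (+ M) 0)) (toℚᵘ-recip (k′ ℕ.+ m ℕ.* k)) ⟩
    ℚᵘ.mkℚᵘ (+ M) 0 ℚᵘ.* ℚᵘ.mkℚᵘ (+ 1) (k′ ℕ.+ m ℕ.* k)     ≈⟨ ℚᵘ.*≡* eq ⟩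
    ℚᵘ.mkℚᵘ (+ 1) k′                                        ≈⟨ toℚᵘ-recip k′ ⟨
    toℚᵘ (recip k)                                          ∎)
    where
    open ℚᵘ.≃-Reasoning
    eq : (+ M ℤ.* + 1) ℤ.* + k ≡ + 1 ℤ.* (+ 1 ℤ.* + (M ℕ.* k))
    eq = trans (cong (ℤ._* + k) (ℤ.*-identityʳ (+ M)))
        (trans (sym (ℤ.pos-* M k))
        (sym (trans (ℤ.*-identityˡ _) (ℤ.*-identityˡ _))))

  ∑-recip : ∀ M k .{{_ : NonZero M}} .{{_ : NonZero k}} → ∑ M (λ _ → recip (M ℕ.* k)) ≡ recip k
  ∑-recip M k = trans (∑-const M _) (recip-scale M k)

  refine : ∀ n N M g → ∑ ((n ∸ 1) ℕ.* (N ℕ.* M)) g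
         ≡ ∑ ((n ∸ 1) ℕ.* N) (λ i → ∑ M (λ j → g (i ℕ.* M ℕ.+ j)))
  refine n N M g = trans (cong (λ m → ∑ m g) (sym (ℕ.*-assoc (n ∸ 1) N M))) (∑-blocks ((n ∸ 1) ℕ.* N) M g)

  shift : ∀ N M i j → N ℕ.* M ℕ.+ (i ℕ.* M ℕ.+ j) ≡ M ℕ.* (N ℕ.+ i) ℕ.+ j
  shift N M i j = trans (sym (ℕ.+-assoc (N ℕ.* M) (i ℕ.* M) j))
    (cong (ℕ._+ j) (trans (sym (ℕ.*-distribʳ-+ M N i)) (ℕ.*-comm (N ℕ.+ i) M)))

  lowerSum-refine : ∀ n N M .{{_ : NonZero M}} → lowerSum n N ≤ lowerSum n (N ℕ.* M)
  lowerSum-refine n N M = subst (lowerSum n N ≤_) (sym (refine n N M _))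
    (∑-mono ((n ∸ 1) ℕ.* N) λ i → ≤-trans (≤-reflexive (sym (∑-recip M (suc (N ℕ.+ i)))))
      (∑-mono-< M λ j j<M → recip-antitone (subst₂ ℕ._≤_
        (trans (ℕ.+-suc (M ℕ.* (N ℕ.+ i)) j) (cong suc (sym (shift N M i j))))
        (trans (ℕ.+-comm _ M) (sym (ℕ.*-suc M (N ℕ.+ i))))
        (ℕ.+-monoʳ-≤ (M ℕ.* (N ℕ.+ i)) j<M))))

  upperSum-refine : ∀ n N M .{{_ : NonZero N}} .{{_ : NonZero M}} → upperSum n (N ℕ.* M) ≤ upperSum n N
  upperSum-refine n N@(suc _) M@(suc _) = subst (_≤ upperSum n N) (sym (refine n N M _))
    (∑-mono ((n ∸ 1) ℕ.* N) λ i → ≤-trans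
      (∑-mono M λ j → recip-antitone (ℕ.≤-trans (ℕ.m≤m+n (M ℕ.* (N ℕ.+ i)) j)
        (ℕ.≤-reflexive (sym (shift N M i j)))))
      (≤-reflexive (∑-recip M (N ℕ.+ i))))

  lowerSum≤upperSum : ∀ n N M .{{_ : NonZero N}} .{{_ : NonZero M}} → lowerSum n N ≤ upperSum n M
  lowerSum≤upperSum n N@(suc _) M@(suc _) = begin
    lowerSum n N          ≤⟨ lowerSum-refine n N M ⟩
    lowerSum n (N ℕ.* M)  ≤⟨ ∑-mono ((n ∸ 1) ℕ.* (N ℕ.* M)) (λ i → recip-antitone (ℕ.n≤1+n (N ℕ.* M ℕ.+ i))) ⟩
    upperSum n (N ℕ.* M)  ≡⟨ cong (upperSum n) (ℕ.*-comm N M) ⟩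
    upperSum n (M ℕ.* N)  ≤⟨ upperSum-refine n M N ⟩
    upperSum n M          ∎
    where open ≤-Reasoning

  telescope : ∀ N m → ∑ m (λ i → recip (N ℕ.+ i)) + recip (N ℕ.+ m)
                    ≡ ∑ m (λ i → recip (suc (N ℕ.+ i))) + recip N
  telescope N zero    = cong (λ k → 0ℚ + recip k) (ℕ.+-identityʳ N)
  telescope N (suc m) = begin
    (∑ m u + recip (N ℕ.+ m)) + recip (N ℕ.+ suc m)  ≡⟨ cong₂ _+_ (telescope N m) (cong recip (ℕ.+-suc N m)) ⟩
    (∑ m v + recip N) + recip (suc (N ℕ.+ m))        ≡⟨ swap (∑ m v) (recip N) (recip (suc (N ℕ.+ m))) ⟩
    (∑ m v + recip (suc (N ℕ.+ m))) + recip N        ∎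
    where
    open ≡-Reasoning
    u v : ℕ → ℚ
    u i = recip (N ℕ.+ i)
    v i = recip (suc (N ℕ.+ i))
    swap : ∀ a b c → (a + b) + c ≡ (a + c) + b
    swap = solve 3 (λ a b c → (a :+ b) :+ c := (a :+ c) :+ b) refl
      where open +-*-Solver

  recip-nonneg : ∀ k → 0ℚ ≤ recip k
  recip-nonneg zero    = ≤-refl
  recip-nonneg (suc k) = toℚᵘ-cancel-≤ (ℚᵘ.≤-respʳ-≃ (ℚᵘ.≃-sym (toℚᵘ-recip k)) (ℚᵘ.nonNegative⁻¹ _))

  upperSum≤lowerSum : ∀ n N → upperSum n N ≤ lowerSum n N + recip N
  upperSum≤lowerSum n N = begin
    upperSum n N                ≡⟨ +-identityʳ _ ⟨
    upperSum n N + 0ℚ           ≤⟨ +-monoʳ-≤ (upperSum n N) (recip-nonneg (N ℕ.+ m)) ⟩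
    upperSum n N + recip (N ℕ.+ m)  ≡⟨ telescope N m ⟩
    lowerSum n N + recip N      ∎
    where
    open ≤-Reasoning
    m = (n ∸ 1) ℕ.* N

  archimedean : ∀ p → 0ℚ < p → ∃ λ k → recip (suc k) < p
  archimedean p@(mkℚ +[1+ a ] b _) _ = suc b , toℚᵘ-cancel-<
    (ℚᵘ.<-respˡ-≃ (ℚᵘ.≃-sym (toℚᵘ-recip (suc b))) (ℚᵘ.*<* (subst (ℤ._< +[1+ a ] ℤ.* + suc (suc b))
      (sym (ℤ.*-identityˡ (+ suc b))) (ℤ.+<+ (ℕ.≤-trans (ℕ.n<1+n (suc b)) (ℕ.m≤n*m (suc (suc b)) (suc a)))))))
  archimedean (mkℚ (+ 0) b _)      (*<* (ℤ.+<+ ()))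
  archimedean (mkℚ ℤ.-[1+ a ] b _) (*<* ())

  below-or-above : ∀ n {q r} → q < r →
                   (∃ λ N → q < lowerSum n (suc N)) ⊎ (∃ λ N → upperSum n (suc N) < r)
  below-or-above n {q} {r} q<r with archimedean (r - q) 0<r-q
    where
    0<r-q : 0ℚ < r - q
    0<r-q = subst (_< r - q) (+-inverseʳ q) (+-monoˡ-< (- q) q<r)
  ... | N , small with q <? lowerSum n (suc N)
  ...   | yes q<L = inj₁ (N , q<L)
  ...   | no  q≮L = inj₂ (N , (begin-strict
    upperSum n (suc N)                  ≤⟨ upperSum≤lowerSum n (suc N) ⟩
    lowerSum n (suc N) + recip (suc N)  ≤⟨ +-monoˡ-≤ (recip (suc N)) (≮⇒≥ q≮L) ⟩
    q + recip (suc N)                   <⟨ +-monoʳ-< q small ⟩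
    q + (r - q)                         ≡⟨ cancel q r ⟩
    r                                   ∎))
    where
    open ≤-Reasoning
    cancel : ∀ q r → q + (r - q) ≡ r
    cancel = solve 2 (λ q r → q :+ (r :- q) := r) refl
      where open +-*-Solver

-- ln n = ∫₁ⁿ dt/t for n ≥ 1; the value at n = 0 is junk.
ln : ℕ → ℝ
ln n = record
  { lower           = λ q → ∃ λ N → q < lowerSum n (suc N)
  ; upper           = λ q → ∃ λ N → upperSum n (suc N) < q
  ; lower-inhabited = lowerSum n 1 - 1ℚ , 0 , q-1<q (lowerSum n 1)
  ; upper-inhabited = upperSum n 1 + 1ℚ , 0 , q<q+1 (upperSum n 1)
  ; lower-rounded   = λ q → mk⇔
      (λ (N , q<L) → let (r , q<r , r<L) = <-dense q<L in r , q<r , N , r<L)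
      (λ (r , q<r , N , r<L) → N , <-trans q<r r<L)
  ; upper-rounded   = λ q → mk⇔
      (λ (N , U<q) → let (r , U<r , r<q) = <-dense U<q in r , r<q , N , U<r)
      (λ (r , r<q , N , U<r) → N , <-trans U<r r<q)
  ; disjoint        = λ q ((N , q<L) , (M , U<q)) →
      <-irrefl refl (<-≤-trans q<L (≤-trans (lowerSum≤upperSum n (suc N) (suc M)) (<⇒≤ U<q)))
  ; located         = below-or-above n
  }

-- lim f(n)/ln n = ∞. Since ln n > 0 for n ≥ 2, f(n)/ln n > K means K · ln n < f(n).
DominatesLn : (ℕ → ℝ) → Set
DominatesLn f = ∀ (K : ℚ) .{{_ : Positive K}} → ∃ λ N → ∀ n → N ℕ.≤ n → K · ln n <ᴿ f n

------------------------------------------------------------------------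
-- Languages, structures and formulas

record Language : Set where
  field
    #symbols   : ℕ
    nonempty   : 1 ℕ.≤ #symbols
    arity      : Fin #symbols → ℕ
    arity≥2    : ∀ R → 2 ℕ.≤ arity R

  Symbol : Set
  Symbol = Fin #symbols

open Language public using (Symbol; arity)

-- Structures with universe {1,…,n}, represented by Fin n.
record Structure (L : Language) (n : ℕ) : Set where
  field
    rel : (R : Symbol L) → Vec (Fin n) (arity L R) → Bool

open Structure public

-- Relations are functions, so structures are compared (and counted) up to
-- having the same relations, as there is no function extensionality.
structureSetoid : Language → ℕ → Setoid _ _
structureSetoid L n = record
  { Carrier       = Structure L n
  ; _≈_           = λ M M′ → ∀ R v → rel M R v ≡ rel M′ R v
  ; isEquivalence = record
    { refl  = λ R v → refl
    ; sym   = λ e R v → sym (e R v)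
    ; trans = λ e e′ R v → trans (e R v) (e′ R v)
    }
  }

-- Well-scoped first-order formulas with free variables among Fin k; a quantifier
-- binds variable 0 of its body.
data Formula (L : Language) : ℕ → Set where
  _≐_  : ∀ {k} → Fin k → Fin k → Formula L k
  atom : ∀ {k} (R : Symbol L) → Vec (Fin k) (arity L R) → Formula L k
  ⊥′   : ∀ {k} → Formula L k
  _∧′_ : ∀ {k} → Formula L k → Formula L k → Formula L k
  _∨′_ : ∀ {k} → Formula L k → Formula L k → Formula L k
  _⇒′_ : ∀ {k} → Formula L k → Formula L k → Formula L k
  ∀′_  : ∀ {k} → Formula L (suc k) → Formula L k
  ∃′_  : ∀ {k} → Formula L (suc k) → Formula L k

infix 4 _⊨_[_]

_⊨_[_] : ∀ {L n k} → Structure L n → Formula L k → Vec (Fin n) k → Set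
M ⊨ x ≐ y    [ ρ ] = lookup ρ x ≡ lookup ρ y
M ⊨ atom R v [ ρ ] = rel M R (map (lookup ρ) v) ≡ true
M ⊨ ⊥′       [ ρ ] = ⊥
M ⊨ φ ∧′ ψ   [ ρ ] = M ⊨ φ [ ρ ] × M ⊨ ψ [ ρ ]
M ⊨ φ ∨′ ψ   [ ρ ] = M ⊨ φ [ ρ ] ⊎ M ⊨ ψ [ ρ ]
M ⊨ φ ⇒′ ψ   [ ρ ] = M ⊨ φ [ ρ ] → M ⊨ ψ [ ρ ]
M ⊨ ∀′ φ     [ ρ ] = ∀ a → M ⊨ φ [ a ∷ ρ ]
M ⊨ ∃′ φ     [ ρ ] = ∃ λ a → M ⊨ φ [ a ∷ ρ ]

data QuantifierFree {L : Language} {k : ℕ} : Formula L k → Set where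
  _≐_  : ∀ x y → QuantifierFree (x ≐ y)
  atom : ∀ R v → QuantifierFree (atom R v)
  ⊥′   : QuantifierFree ⊥′
  _∧′_ : ∀ {φ ψ} → QuantifierFree φ → QuantifierFree ψ → QuantifierFree (φ ∧′ ψ)
  _∨′_ : ∀ {φ ψ} → QuantifierFree φ → QuantifierFree ψ → QuantifierFree (φ ∨′ ψ)
  _⇒′_ : ∀ {φ ψ} → QuantifierFree φ → QuantifierFree ψ → QuantifierFree (φ ⇒′ ψ)

-- Existentially quantifies the first t variables.
∃^ : ∀ {L k} t → Formula L (t ℕ.+ k) → Formula L k
∃^ zero    φ = φ
∃^ (suc t) φ = ∃^ t (∃′ φ)

------------------------------------------------------------------------
-- Colourings

Colouring : ℕ → ℕ → Set
Colouring n l = Fin n → Fin l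

data Kind : Set where
  weak strong : Kind

IsColouring : ∀ {L n l} → Kind → Structure L n → Colouring n l → Set
IsColouring weak   M γ = ∀ R v → rel M R v ≡ true →
  ∃₂ λ i j → γ (lookup v i) ≢ γ (lookup v j)
IsColouring strong M γ = ∀ R v → rel M R v ≡ true →
  ∀ i j → i ≢ j → γ (lookup v i) ≢ γ (lookup v j)

-- Membership in 𝐂ₙ, respectively 𝐒ₙ.
Colourable : ∀ {L n} → Kind → ℕ → Structure L n → Set
Colourable {n = n} κ l M = Σ (Colouring n l) (IsColouring κ M)

Rich : ∀ {n l} → ℝ → Colouring n l → Set
Rich {n} x γ = ∀ i → x ≤ᴿ ℚ⇒ℝ (ℕ⇒ℚ (count (λ a → γ a Fin.≟ i) (allFin n)))

HasRichColouring : ∀ {L n} → Kind → ℕ → (ℕ → ℝ) → Structure L n → Set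
HasRichColouring {n = n} κ l f M = Σ (Colouring n l) λ γ → IsColouring κ M γ × Rich (f n) γ

UniquelyColourable : ∀ {L n} → Kind → ℕ → Structure L n → Set
UniquelyColourable {n = n} κ l M = Σ (Colouring n l) λ γ → IsColouring κ M γ ×
  (∀ δ → IsColouring κ M δ → Σ (Permutation′ l) λ π → ∀ a → δ a ≡ π ⟨$⟩ʳ γ a)

DefinedBy : ∀ {L n l} → Formula L 2 → Structure L n → Colouring n l → Set
DefinedBy ξ M γ = ∀ a b → (M ⊨ ξ [ a ∷ b ∷ [] ]) ⇔ (γ a ≡ γ b)

AllColouringsDefinedBy : ∀ {L n} → Kind → ℕ → Formula L 2 → Structure L n → Set
AllColouringsDefinedBy {n = n} κ l ξ M = ∀ (γ : Colouring n l) → IsColouring κ M γ → DefinedBy ξ M γ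

------------------------------------------------------------------------
-- The formula ξ

-- The universe of 𝒮 has s = t + 2 elements; its last two elements s-1 and s are:
penultimate ultimate : ∀ t → Fin (t ℕ.+ 2)
penultimate t = t ↑ʳ zero
ultimate    t = t ↑ʳ suc zero

record ForcesEqualColours {L t} (κ : Kind) (l : ℕ) (S : Structure L (t ℕ.+ 2)) : Set where
  field
    s≥3        : 3 ℕ.≤ t ℕ.+ 2
    colourable : Colourable κ l S
    forced     : ∀ (γ : Colouring (t ℕ.+ 2) l) → IsColouring κ S γ →
                 γ (penultimate t) ≡ γ (ultimate t)
    attained   : ∀ (i : Fin l) → Σ (Colouring (t ℕ.+ 2) l) λ γ →
                 IsColouring κ S γ × γ (penultimate t) ≡ i × γ (ultimate t) ≡ i

-- aᵢ ↦ i is an isomorphism from M↾{a₁,…,aₛ} to S. It is a well-defined map exactly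
-- when the aᵢ are distinct, and is then automatically bijective.
record IsIsomorphism {L n s} (M : Structure L n) (a : Vec (Fin n) s) (S : Structure L s) : Set where
  field
    distinct  : Injective _≡_ _≡_ (lookup a)
    preserves : ∀ R v → rel M R (map (lookup a) v) ≡ rel S R v

record Characterises {L s} (χ : Formula L s) (S : Structure L s) : Set where
  field
    quantifierFree : QuantifierFree χ
    correct        : ∀ {n} (M : Structure L n) (a : Vec (Fin n) s) →
                     (M ⊨ χ [ a ]) ⇔ IsIsomorphism M a S

-- ξ(y,z), where y is variable 0 and z is variable 1.
ξ : ∀ {L} t → Formula L (t ℕ.+ 2) → Formula L 2
ξ t χ = (zero ≐ suc zero) ∨′ ∃^ t χ

------------------------------------------------------------------------
-- Proportions

module _ {L : Language} {n : ℕ} where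
  open Membership (structureSetoid L n) using (_∈_)
  open Unique (structureSetoid L n) using (Unique)

  -- The proportion of the M satisfying P which also satisfy Q is at least p. Nothing
  -- makes Q decidable (richness compares with a real number), so the numerator
  -- is bounded below by the length of a repetition-free list of examples.
  record ProportionAtLeast (p : ℚ) (P Q : Structure L n → Set) : Set where
    field
      all          : List (Structure L n)
      all-unique   : Unique all
      all-sound    : All P all
      all-complete : ∀ M → P M → M ∈ all
      good         : List (Structure L n)
      good-unique  : Unique good
      good-sound   : All (λ M → P M × Q M) good
      bound        : p * ℕ⇒ℚ (length all) ≤ ℕ⇒ℚ (length good)

-- The proportion of M ∈ 𝐂ₙ (respectively 𝐒ₙ) satisfying Q tends to 1 as n → ∞.
AlmostAll : ∀ L → Kind → ℕ → (∀ {n} → Structure L n → Set) → Set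
AlmostAll L κ l Q = ∀ ε → 0ℚ < ε → ∃ λ N → ∀ n → N ℕ.≤ n →
  ProportionAtLeast {L} {n} (1ℚ - ε) (Colourable κ l) Q

{-# OPTIONS --safe #-}

-- Count pairs (M , γ) of a structure and one of its colourings in which every colour class is
-- large. A pattern of bounded size which may occur at some prescribed roots fits into many
-- places of M that are disjoint outside the roots, and planting it at one place does not
-- affect the others. Planting is at most q-to-one, where q is the number of structures on the
-- vertices of the pattern, so every q further places halve the number of pairs in which the
-- pattern is missing from all of them. Class sizes growing faster than ln n leave room for
-- more halvings than the union bound over the roots needs.
--
-- Apply this to 𝒮 with two roots of equal colour, and to a complete structure with one vertex
-- of each colour. If both are always present, every colouring of M induces the same partition
-- as γ: copies of 𝒮 keep the classes of γ together and the complete structure keeps them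
-- apart. Such an M has boundedly many colourings, so that counting pairs instead of
-- structures loses only a constant factor.

module Submission where

open import Defs
open import Data.Bool.Base using (Bool; true; false; if_then_else_)
import Data.Bool.Properties as Bool
open import Data.Fin.Base
  using (Fin; zero; suc; toℕ; fromℕ; fromℕ<; inject₁; inject≤; lower₁; punchOut; cast; splitAt;
         combine; remQuot; _↑ˡ_; _↑ʳ_)
import Data.Fin.Base as Fin using (_<_)
open import Data.Fin.Permutation using (Permutation′; _⟨$⟩ʳ_; permutation)
import Data.Fin.Permutation.Components as PC
import Data.Fin.Properties as Fin
open import Data.Integer.Base using (+[1+_])
import Data.Integer.Base as ℤ
import Data.Integer.Properties as ℤ
open import Data.List.Base using (List; []; _∷_; length; filter; cartesianProduct; cartesianProductWith)
import Data.List.Base as List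
import Data.List.Membership.Setoid as Membership
import Data.List.Membership.Setoid.Properties as ∈ₛ
open import Data.List.Membership.Propositional using (_∈_)
open import Data.List.Membership.Propositional.Properties
  using (∈-lookup; ∈-allFin; ∈-filter⁻; ∈-map⁺; ∈-concat⁺′; ∈-cartesianProductWith⁺; ∈-cartesianProduct⁻)
import Data.List.Properties as List
open import Data.List.Relation.Unary.All using (All; []; _∷_)
import Data.List.Relation.Unary.All as All
import Data.List.Relation.Unary.All.Properties as All
open import Data.List.Relation.Unary.AllPairs using ([]; _∷_)
open import Data.List.Relation.Unary.Any using (Any; any?; index; here; there; satisfied)
import Data.List.Relation.Unary.Any as Any
open import Data.List.Relation.Unary.Any.Properties using (lookup-index)
import Data.List.Relation.Unary.Unique.Propositional as Propositional
import Data.List.Relation.Unary.Unique.Propositional.Properties as UniqueP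
open import Data.List.Relation.Unary.Unique.Setoid using (Unique)
import Data.List.Relation.Unary.Unique.Setoid.Properties as UniqueS
open import Data.Nat.Base using (ℕ; zero; suc; _+_; _*_; _^_; _∸_; _⊔_; _≤_; _<_; z≤n; s≤s; NonZero)
open import Data.Nat.Properties
open import Data.Product.Base using (Σ; ∃; ∃₂; _×_; _,_; proj₁; proj₂; uncurry)
import Data.Product.Properties as Product
open import Data.Product.Relation.Binary.Pointwise.NonDependent using (_×ₛ_)
open import Data.Rational.Base using (ℚ; mkℚ; 0ℚ; 1ℚ; ½; 1/_; *<*)
import Data.Rational.Base as ℚ
import Data.Rational.Properties as ℚ
open import Data.Rational.Solver using (module +-*-Solver)
open import Data.Rational.Unnormalised.Base using (mkℚᵘ; *≡*; *≤*)
import Data.Rational.Unnormalised.Base as ℚᵘ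
import Data.Rational.Unnormalised.Properties as ℚᵘ
open import Data.Sum.Base using (_⊎_; inj₁; inj₂; [_,_]′)
open import Data.Unit.Base using (⊤; tt)
open import Data.Vec.Base using (Vec; []; _∷_; lookup; map; tabulate; replicate; count; allFin; _++_)
open import Data.Vec.Properties
  using (∷-injective; ≡-dec; lookup-map; lookup∘tabulate; tabulate∘lookup; tabulate-cong;
         lookup-++ˡ; lookup-++ʳ; lookup-replicate)
open import Function.Base using (_∘_; id)
open import Function.Bundles using (mk⇔; Equivalence)
open import Function.Definitions using (Injective)
open import Level using (Level)
open import Relation.Binary.Bundles using (Setoid)
open import Relation.Binary.Definitions using (DecidableEquality; _Respects_; tri<; tri≈; tri>)
open import Relation.Binary.PropositionalEquality
open import Relation.Nullary using (¬_; Dec; yes; no; contradiction; does; ¬?)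
open import Relation.Nullary.Decidable using (map′; dec-true; decidable-stable; _→-dec_; _×-dec_; _⊎-dec_)
open import Relation.Unary using (Decidable)

private variable
  ℓ ℓ′ ℓ₁ ℓ₂ ℓ₃ : Level
  n n′ l l′ m s : ℕ
  L : Language

-- Counting in lists

module _ (X : Setoid ℓ ℓ′) where
  open Setoid X using (Carrier; _≈_) renaming (sym to ≈-sym; trans to ≈-trans)

  Unique-lookup-injective : ∀ {xs} → Unique X xs →
                            ∀ i j → List.lookup xs i ≈ List.lookup xs j → i ≡ j
  Unique-lookup-injective (_ ∷ _)  zero    zero    _ = refl
  Unique-lookup-injective (x# ∷ _) zero    (suc j) e = contradiction e (All.lookup x# (∈-lookup j))
  Unique-lookup-injective (x# ∷ _) (suc i) zero    e = contradiction (≈-sym e) (All.lookup x# (∈-lookup i))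
  Unique-lookup-injective (_ ∷ u)  (suc i) (suc j) e = cong suc (Unique-lookup-injective u i j e)

  -- Positions of `xs` that receive the same index hold equivalent entries, so by uniqueness they
  -- coincide; what remains is an injection into `Fin N`. Injections and bounded-to-one maps between
  -- lists become inequalities in this way.
  length-≤-cover : ∀ {N xs} → Unique X xs → (h : Fin N → Carrier) →
                   All (λ x → ∃ λ i → x ≈ h i) xs → length xs ≤ N
  length-≤-cover u h cov = Fin.injective⇒≤ λ {i} {j} e →
    Unique-lookup-injective u i j (≈-trans (at i) (≈-trans (reflexive′ (cong h e)) (≈-sym (at j))))
    where
    reflexive′ = Setoid.reflexive X
    at = λ i → proj₂ (All.lookup cov (∈-lookup i))

  length-≤-cover₂ : ∀ {M N xs} → Unique X xs → (h : Fin M → Fin N → Carrier) →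
                    All (λ x → ∃₂ λ i j → x ≈ h i j) xs → length xs ≤ M * N
  length-≤-cover₂ {M} {N} u h cov = length-≤-cover u (λ k → uncurry h (remQuot N k))
    (All.map (λ (i , j , e) → combine i j ,
      subst (λ ij → _ ≈ uncurry h ij) (sym (Fin.remQuot-combine i j)) e) cov)

module _ {A : Set ℓ} where

  module _ {P : A → Set ℓ₁} {Q : A → Set ℓ₂} {R : A → Set ℓ₃}
           (P? : Decidable P) (Q? : Decidable Q) (R? : Decidable R) where

    length-filter-∪ : (∀ {x} → P x → Q x ⊎ R x) → ∀ xs →
      length (filter P? xs) ≤ length (filter Q? xs) + length (filter R? xs)
    length-filter-∪ f [] = z≤n
    length-filter-∪ f (x ∷ xs) with ih ← length-filter-∪ f xs | P? x | Q? x | R? x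
    ... | no _  | no _  | no _  = ih
    ... | no _  | no _  | yes _ = ≤-trans ih (+-monoʳ-≤ _ (n≤1+n _))
    ... | no _  | yes _ | no _  = m≤n⇒m≤1+n ih
    ... | no _  | yes _ | yes _ = m≤n⇒m≤1+n (≤-trans ih (+-monoʳ-≤ _ (n≤1+n _)))
    ... | yes _ | yes _ | no _  = s≤s ih
    ... | yes _ | yes _ | yes _ = s≤s (≤-trans ih (+-monoʳ-≤ _ (n≤1+n _)))
    ... | yes _ | no _  | yes _ = ≤-trans (s≤s ih) (≤-reflexive (sym (+-suc _ _)))
    ... | yes y | no ¬q | no ¬r = contradiction (f y) [ ¬q , ¬r ]′

    length-filter-⊎ : (∀ {x} → Q x → P x × ¬ R x) → (∀ {x} → R x → P x) → ∀ xs →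
      length (filter Q? xs) + length (filter R? xs) ≤ length (filter P? xs)
    length-filter-⊎ f g [] = z≤n
    length-filter-⊎ f g (x ∷ xs) with ih ← length-filter-⊎ f g xs | P? x | Q? x | R? x
    ... | no _  | no _  | no _  = ih
    ... | no ¬y | yes z | _     = contradiction (proj₁ (f z)) ¬y
    ... | no ¬y | no _  | yes z = contradiction (g z) ¬y
    ... | yes _ | yes y | yes z = contradiction z (proj₂ (f y))
    ... | yes _ | yes _ | no _  = s≤s ih
    ... | yes _ | no _  | yes _ = ≤-trans (≤-reflexive (+-suc _ _)) (s≤s ih)
    ... | yes _ | no _  | no _  = m≤n⇒m≤1+n ih

  length-≤-filter-¬ : ∀ {P : A → Set ℓ₁} (P? : Decidable P) xs →
    length xs ≤ length (filter P? xs) + length (filter (¬? ∘ P?) xs)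
  length-≤-filter-¬ P? [] = z≤n
  length-≤-filter-¬ P? (x ∷ xs) with ih ← length-≤-filter-¬ P? xs | P? x
  ... | yes _ = s≤s ih
  ... | no _  = ≤-trans (s≤s ih) (≤-reflexive (sym (+-suc _ _)))

  module _ {P : A → Set ℓ₁} {Q : A → Set ℓ₂} (P? : Decidable P) (Q? : Decidable Q) where

    length-filter-⊆ : (∀ {x} → P x → Q x) → ∀ xs → length (filter P? xs) ≤ length (filter Q? xs)
    length-filter-⊆ f [] = z≤n
    length-filter-⊆ f (x ∷ xs) with ih ← length-filter-⊆ f xs | P? x | Q? x
    ... | no _  | no _  = ih
    ... | no _  | yes _ = m≤n⇒m≤1+n ih
    ... | yes _ | yes _ = s≤s ih
    ... | yes y | no ¬z = contradiction (f y) ¬z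

  -- The factor `c` stays on the left because each single bound comes as `2 ^ j` times a count, so
  -- nothing has to be divided.
  union-bound : ∀ {N} {P : Fin N → A → Set ℓ₁} {Q : A → Set ℓ₂}
    (P? : ∀ i → Decidable (P i)) (Q? : Decidable Q) →
    (∀ {x} → Q x → ∃ λ i → P i x) → ∀ xs c m →
    (∀ i → c * length (filter (P? i) xs) ≤ m) → c * length (filter Q? xs) ≤ N * m
  union-bound {N = zero} P? Q? f xs c m b
    rewrite List.filter-none Q? {xs} (All.universal (λ x y → Fin.¬Fin0 (proj₁ (f y))) xs) | *-zeroʳ c = z≤n
  union-bound {N = suc N} {P} {Q} P? Q? f xs c m b = begin
    c * length (filter Q? xs)
      ≤⟨ *-monoʳ-≤ c (length-filter-∪ Q? (P? zero) rest? split xs) ⟩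
    c * (length (filter (P? zero) xs) + length (filter rest? xs))
      ≡⟨ *-distribˡ-+ c _ _ ⟩
    c * length (filter (P? zero) xs) + c * length (filter rest? xs)
      ≤⟨ +-mono-≤ (b zero) (union-bound (P? ∘ suc) rest? id xs c m (b ∘ suc)) ⟩
    m + N * m                                                        ∎
    where
    open ≤-Reasoning
    rest? : Decidable (λ x → ∃ λ i → P (suc i) x)
    rest? x = Fin.any? (λ i → P? (suc i) x)
    split : ∀ {x} → Q x → P zero x ⊎ ∃ λ i → P (suc i) x
    split y with f y
    ... | zero  , z = inj₁ z
    ... | suc i , z = inj₂ (i , z)

module _ {A : Set ℓ} where

  vectors : List A → ∀ n → List (Vec A n)
  vectors xs zero    = [] ∷ []
  vectors xs (suc n) = cartesianProductWith _∷_ xs (vectors xs n)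

  vectors-unique : ∀ {xs} → Propositional.Unique xs → ∀ n → Propositional.Unique (vectors xs n)
  vectors-unique u zero    = [] ∷ []
  vectors-unique u (suc n) = UniqueP.cartesianProductWith⁺ _∷_ ∷-injective u (vectors-unique u n)

  vectors-complete : ∀ {xs} → (∀ x → x ∈ xs) → ∀ {n} (v : Vec A n) → v ∈ vectors xs n
  vectors-complete c []      = here refl
  vectors-complete c (x ∷ v) = ∈-cartesianProductWith⁺ _∷_ (c x) (vectors-complete c v)

-- Iterated halving.

module _ (q : ℕ) .{{_ : NonZero q}} where

  -- Each step removes at least x k / q ≥ x q / q, so q steps remove at least x q.
  halving : ∀ (x : ℕ → ℕ) → (∀ k → k < q → q * x (suc k) + x k ≤ q * x k) → 2 * x q ≤ x 0
  halving x step = *-cancelˡ-≤ q (begin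
    q * (2 * x q)        ≡⟨ cong (λ z → q * (x q + z)) (+-identityʳ (x q)) ⟩
    q * (x q + x q)      ≡⟨ *-distribˡ-+ q (x q) (x q) ⟩
    q * x q + q * x q    ≤⟨ partial q ≤-refl ⟩
    q * x 0              ∎)
    where
    open ≤-Reasoning
    decreasing : ∀ k → k < q → x (suc k) ≤ x k
    decreasing k k<q = *-cancelˡ-≤ q (≤-trans (m≤m+n _ (x k)) (step k k<q))
    partial : ∀ i → i ≤ q → q * x i + i * x i ≤ q * x 0
    partial zero    _   = ≤-reflexive (+-identityʳ _)
    partial (suc i) i<q = begin
      q * x (suc i) + (x (suc i) + i * x (suc i))  ≡⟨ +-assoc (q * x (suc i)) _ _ ⟨
      q * x (suc i) + x (suc i) + i * x (suc i)
        ≤⟨ +-mono-≤ (+-monoʳ-≤ (q * x (suc i)) (decreasing i i<q)) (*-monoʳ-≤ i (decreasing i i<q)) ⟩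
      q * x (suc i) + x i + i * x i                ≤⟨ +-monoˡ-≤ (i * x i) (step i i<q) ⟩
      q * x i + i * x i                            ≤⟨ partial i (<⇒≤ i<q) ⟩
      q * x 0                                      ∎

  -- Induction handles the first `j * q` steps; the last `q` steps are `halving` for the sequence
  -- shifted by `j * q`.
  halving-iterated : ∀ j (x : ℕ → ℕ) → (∀ k → k < j * q → q * x (suc k) + x k ≤ q * x k) →
                     2 ^ j * x (j * q) ≤ x 0
  halving-iterated zero    x step = ≤-reflexive (+-identityʳ _)
  halving-iterated (suc j) x step = begin
    2 * 2 ^ j * x (q + j * q)    ≡⟨ cong (_* x (q + j * q)) (*-comm 2 (2 ^ j)) ⟩
    2 ^ j * 2 * x (q + j * q)    ≡⟨ *-assoc (2 ^ j) 2 _ ⟩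
    2 ^ j * (2 * x (q + j * q))  ≡⟨ cong (λ k → 2 ^ j * (2 * x k)) (+-comm q (j * q)) ⟩
    2 ^ j * (2 * x (j * q + q))  ≤⟨ *-monoʳ-≤ (2 ^ j) (halving (λ k → x (j * q + k)) later) ⟩
    2 ^ j * x (j * q + 0)        ≡⟨ cong (λ k → 2 ^ j * x k) (+-identityʳ (j * q)) ⟩
    2 ^ j * x (j * q)            ≤⟨ halving-iterated j x (λ k k< → step k (<-≤-trans k< (m≤n+m (j * q) q))) ⟩
    x 0                          ∎
    where
    open ≤-Reasoning
    later : ∀ k → k < q → q * x (j * q + suc k) + x (j * q + k) ≤ q * x (j * q + k)
    later k k<q rewrite +-suc (j * q) k =
      step (j * q + k) (subst (j * q + k <_) (+-comm (j * q) q) (+-monoʳ-< (j * q) k<q))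

-- Colourings and embeddings of structures

-- The condition of `IsColouring` on a single tuple, isolated so that later arguments can treat both
-- kinds at once.
Permitted : Kind → Colouring n l → Vec (Fin n) m → Set
Permitted weak   γ v = ∃₂ λ i j → γ (lookup v i) ≢ γ (lookup v j)
Permitted strong γ v = ∀ i j → i ≢ j → γ (lookup v i) ≢ γ (lookup v j)

related⇒permitted : ∀ κ {M : Structure L n} {γ : Colouring n l} → IsColouring κ M γ →
                    ∀ R v → rel M R v ≡ true → Permitted κ γ v
related⇒permitted weak   = id
related⇒permitted strong = id

isColouring : ∀ κ {M : Structure L n} {γ : Colouring n l} →
              (∀ R v → rel M R v ≡ true → Permitted κ γ v) → IsColouring κ M γ
isColouring weak   = id
isColouring strong = id

permitted? : ∀ κ (γ : Colouring n l) (v : Vec (Fin n) m) → Dec (Permitted κ γ v)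
permitted? weak   γ v = Fin.any? λ i → Fin.any? λ j → ¬? (γ (lookup v i) Fin.≟ γ (lookup v j))
permitted? strong γ v = Fin.all? λ i → Fin.all? λ j →
  ¬? (i Fin.≟ j) →-dec ¬? (γ (lookup v i) Fin.≟ γ (lookup v j))

-- Both kinds ask only for inequalities between colours, and these survive when every equality among
-- the new colours comes from one among the old.
Permitted-refine : ∀ κ {γ : Colouring n l} {γ′ : Colouring n′ l′} {v : Vec (Fin n) m} {v′ : Vec (Fin n′) m} →
  (∀ i j → γ′ (lookup v′ i) ≡ γ′ (lookup v′ j) → γ (lookup v i) ≡ γ (lookup v j)) →
  Permitted κ γ v → Permitted κ γ′ v′
Permitted-refine weak   f (i , j , ≢) = i , j , ≢ ∘ f i j
Permitted-refine strong f ≢ i j i≢j   = ≢ i j i≢j ∘ f i j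

Permitted-∘ : ∀ κ {γ : Colouring n l} {ε : Fin s → Fin n} {σ : Colouring s l} → (∀ x → γ (ε x) ≡ σ x) →
              {v : Vec (Fin s) m} → Permitted κ σ v → Permitted κ γ (map ε v)
Permitted-∘ κ {γ} {ε} γε≗σ {v} = Permitted-refine κ λ i j e →
  trans (sym (at i)) (trans e (at j))
  where at = λ i → trans (cong γ (lookup-map i ε v)) (γε≗σ _)

Permitted-∘⁻ : ∀ κ {γ : Colouring n l} {ε : Fin s → Fin n} {σ : Colouring s l} → (∀ x → γ (ε x) ≡ σ x) →
               {v : Vec (Fin s) m} → Permitted κ γ (map ε v) → Permitted κ σ v
Permitted-∘⁻ κ {γ} {ε} γε≗σ {v} = Permitted-refine κ λ i j e →
  trans (at i) (trans e (sym (at j)))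
  where at = λ i → trans (cong γ (lookup-map i ε v)) (γε≗σ _)

monochromatic⇒¬permitted : ∀ κ {γ : Colouring n l} {v : Vec (Fin n) m} → 2 ≤ m →
  (∀ i j → γ (lookup v i) ≡ γ (lookup v j)) → ¬ Permitted κ γ v
monochromatic⇒¬permitted weak   _              mono (i , j , ≢) = ≢ (mono i j)
monochromatic⇒¬permitted strong (s≤s (s≤s _)) mono ≢           = ≢ zero (suc zero) (λ ()) (mono _ _)

∀vec? : ∀ {p} {P : Vec (Fin n) m → Set p} → Decidable P → Dec (∀ v → P v)
∀vec? {m = zero}  P? = map′ (λ { p [] → p }) (λ f → f []) (P? [])
∀vec? {m = suc m} P? = map′ (λ { f (x ∷ v) → f x v }) (λ f x v → f (x ∷ v))
  (Fin.all? λ x → ∀vec? λ v → P? (x ∷ v))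

isColouring? : ∀ κ (M : Structure L n) (γ : Colouring n l) → Dec (IsColouring κ M γ)
isColouring? κ M γ = map′ (isColouring κ) (related⇒permitted κ)
  (Fin.all? λ R → ∀vec? λ v → (rel M R v Bool.≟ true) →-dec permitted? κ γ v)

_≈ˢ_ : Structure L n → Structure L n → Set
_≈ˢ_ {L} {n} M M′ = ∀ R (v : Vec (Fin n) (arity L R)) → rel M R v ≡ rel M′ R v

IsColouring-resp : ∀ κ {M M′ : Structure L n} {γ : Colouring n l} → M ≈ˢ M′ →
                   IsColouring κ M γ → IsColouring κ M′ γ
IsColouring-resp κ M≈M′ c = isColouring κ λ R v r → related⇒permitted κ c R v (trans (M≈M′ R v) r)

pullback : Structure L n → Vec (Fin n) s → Structure L s
pullback M ε = record { rel = λ R v → rel M R (map (lookup ε) v) }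

pullback-IsColouring : ∀ κ {M : Structure L n} {γ : Colouring n l} {S : Structure L s} (ε : Vec (Fin n) s) →
  pullback M ε ≈ˢ S → IsColouring κ M γ → IsColouring κ S (γ ∘ lookup ε)
pullback-IsColouring κ ε ≈S c = isColouring κ λ R v r →
  Permitted-∘⁻ κ (λ _ → refl) (related⇒permitted κ c R _ (trans (≈S R v) r))

map-injective : ∀ {f : Fin s → Fin n} → Injective _≡_ _≡_ f →
                ∀ (u v : Vec (Fin s) m) → map f u ≡ map f v → u ≡ v
map-injective inj []      []      _ = refl
map-injective inj (x ∷ u) (y ∷ v) e = let x≡y , u≡v = ∷-injective e in
  cong₂ _∷_ (inj x≡y) (map-injective inj u v u≡v)

preimage? : ∀ (f : Fin s → Fin n) (v : Vec (Fin n) m) → Dec (∃ λ u → map f u ≡ v)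
preimage? f []      = yes ([] , refl)
preimage? f (x ∷ v) = map′ (λ ((y , e) , (u , e′)) → y ∷ u , cong₂ _∷_ e e′)
  (λ { (y ∷ u , e) → let (e₁ , e₂) = ∷-injective e in (y , e₁) , (u , e₂) })
  (Fin.any? (λ y → f y Fin.≟ x) ×-dec preimage? f v)

-- Only tuples lying entirely in the range of `ε` are rewritten; a tuple with some entry outside
-- keeps its value. Injectivity of `ε` makes the preimage unique.
override : Structure L n → Vec (Fin n) s → Structure L s → Structure L n
override {L} {n} {s} M ε T = record { rel = λ R v → choose R v (preimage? (lookup ε) v) }
  where
  choose : ∀ R (v : Vec (Fin n) (arity L R)) → Dec (∃ λ u → map (lookup ε) u ≡ v) → Bool
  choose R v (yes (u , _)) = rel T R u
  choose R v (no _)        = rel M R v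

module _ {M : Structure L n} {ε : Vec (Fin n) s} {T : Structure L s} where

  override-outside : ∀ R v → ¬ (∃ λ u → map (lookup ε) u ≡ v) → rel (override M ε T) R v ≡ rel M R v
  override-outside R v ∄u with preimage? (lookup ε) v
  ... | yes ∃u = contradiction ∃u ∄u
  ... | no _   = refl

  override-inside : Injective _≡_ _≡_ (lookup ε) → pullback (override M ε T) ε ≈ˢ T
  override-inside inj R u with preimage? (lookup ε) (map (lookup ε) u)
  ... | yes (u′ , e) = cong (rel T R) (map-injective inj u′ u e)
  ... | no ∄u        = contradiction (u , refl) ∄u

override-cong : {M M′ : Structure L n} (ε : Vec (Fin n) s) (T : Structure L s) → M ≈ˢ M′ →
                override M ε T ≈ˢ override M′ ε T
override-cong ε T M≈M′ R v with preimage? (lookup ε) v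
... | yes _ = refl
... | no _  = M≈M′ R v

-- Planting forgets nothing but the former structure on the block. This bounds the number of
-- structures that become equal by planting.
override-restore : {M : Structure L n} (ε : Vec (Fin n) s) (S T : Structure L s) → pullback M ε ≈ˢ T →
                   M ≈ˢ override (override M ε S) ε T
override-restore {M = M} ε S T ≈T R v with preimage? (lookup ε) v
... | yes (u , refl) = ≈T R u
... | no ∄u          = sym (override-outside {M = M} {ε} {S} R v ∄u)

-- Enumerating the structures on a finite universe.

module _ {A : Set} (_≟_ : DecidableEquality A) where

  assign : A → Bool → (A → Bool) → A → Bool
  assign x b f y = if does (y ≟ x) then b else f y

  -- Off the list every enumerated function is `false`, so completeness is agreement on the list;
  -- with all `tuples` listed this becomes agreement everywhere.
  boolFunctions : List A → List (A → Bool)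
  boolFunctions []       = (λ _ → false) ∷ []
  boolFunctions (x ∷ xs) = cartesianProductWith (assign x) (true ∷ false ∷ []) (boolFunctions xs)

  boolFunctions-complete : ∀ (f : A → Bool) xs → ∃ λ g → g ∈ boolFunctions xs × (∀ {x} → x ∈ xs → f x ≡ g x)
  boolFunctions-complete f []       = _ , here refl , λ ()
  boolFunctions-complete f (x ∷ xs) =
    let (g , g∈ , f≗g) = boolFunctions-complete f xs in
    _ , ∈-cartesianProductWith⁺ (assign x) (bool∈ (f x)) g∈ , λ {y} → agree g f≗g y
    where
    bool∈ : ∀ b → b ∈ true ∷ false ∷ []
    bool∈ true  = here refl
    bool∈ false = there (here refl)
    agree : ∀ g → (∀ {y} → y ∈ xs → f y ≡ g y) → ∀ y → y ∈ x ∷ xs → f y ≡ assign x (f x) g y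
    agree g f≗g y y∈ with y ≟ x | y∈
    ... | yes refl | _         = refl
    ... | no y≢x   | here y≡x  = contradiction y≡x y≢x
    ... | no _     | there y∈′ = f≗g y∈′

module _ (L : Language) (s : ℕ) where

  Tuple : Set
  Tuple = Σ (Symbol L) (λ R → Vec (Fin s) (arity L R))

  tuples : List Tuple
  tuples = List.concat (List.map (λ R → List.map (R ,_) (vectors (List.allFin s) (arity L R))) (List.allFin _))

  tuples-complete : ∀ x → x ∈ tuples
  tuples-complete (R , v) = ∈-concat⁺′ (∈-map⁺ (R ,_) (vectors-complete ∈-allFin v))
    (∈-map⁺ (λ R → List.map (R ,_) (vectors (List.allFin s) (arity L R))) (∈-allFin R))

  structures : List (Structure L s)
  structures = List.map (λ f → record { rel = λ R v → f (R , v) })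
    (boolFunctions (Product.≡-dec Fin._≟_ (≡-dec Fin._≟_)) tuples)

  structures-complete : ∀ M → ∃ λ i → M ≈ˢ List.lookup structures i
  structures-complete M =
    let (g , g∈ , f≗g) = boolFunctions-complete (Product.≡-dec Fin._≟_ (≡-dec Fin._≟_))
          (λ (R , v) → rel M R v) tuples
        g∈′ = ∈-map⁺ (λ f → record { rel = λ R v → f (R , v) }) g∈
    in index g∈′ , λ R v → trans (f≗g (tuples-complete (R , v))) (cong (λ T → rel T R v) (lookup-index g∈′))

-- Extending patterns with roots: planting disjoint copies

module _ {A : Set} (d : A) where

  -- Made total by the junk value `d`, so that places can be defined for every `γ`; in rich pairs
  -- the positions used are in range.
  nth : List A → ℕ → A
  nth []       _       = d
  nth (x ∷ xs) zero    = x
  nth (x ∷ xs) (suc k) = nth xs k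

  nth-lookup : ∀ xs {k} (k< : k < length xs) → nth xs k ≡ List.lookup xs (fromℕ< k<)
  nth-lookup (x ∷ xs) {zero}  _        = refl
  nth-lookup (x ∷ xs) {suc k} (s≤s k<) = nth-lookup xs k<

  nth-∈ : ∀ xs {k} → k < length xs → nth xs k ∈ xs
  nth-∈ xs k< = subst (_∈ xs) (sym (nth-lookup xs k<)) (∈-lookup {xs = xs} (fromℕ< k<))

  nth-injective : ∀ {xs} → Propositional.Unique xs → ∀ {j k} → j < length xs → k < length xs →
                  nth xs j ≡ nth xs k → j ≡ k
  nth-injective {xs} u j< k< e = Fin.fromℕ<-injective _ _ j< k<
    (Unique-lookup-injective (setoid A) u _ _ (trans (sym (nth-lookup xs j<)) (trans e (nth-lookup xs k<))))

quotient-< : ∀ {t k k′} (j j′ : Fin t) → k < k′ → k * t + toℕ j < k′ * t + toℕ j′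
quotient-< {t} {k} {k′} j j′ k<k′ = begin-strict
  k * t + toℕ j    <⟨ +-monoʳ-< (k * t) (Fin.toℕ<n j) ⟩
  k * t + t        ≡⟨ +-comm (k * t) t ⟩
  suc k * t        ≤⟨ *-monoˡ-≤ t k<k′ ⟩
  k′ * t           ≤⟨ m≤m+n _ _ ⟩
  k′ * t + toℕ j′  ∎
  where open ≤-Reasoning

-- Uniqueness of division with remainder by `t`. It keeps the positions of different copies of a
-- pattern apart.
quotient-unique : ∀ {t} k k′ (j j′ : Fin t) → k * t + toℕ j ≡ k′ * t + toℕ j′ → k ≡ k′ × j ≡ j′
quotient-unique {t} k k′ j j′ e with <-cmp k k′
... | tri≈ _ refl _ = refl , Fin.toℕ-injective (+-cancelˡ-≡ (k * t) _ _ e)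
... | tri< k<k′ _ _ = contradiction e (<⇒≢ (quotient-< j j′ k<k′))
... | tri> _ _ k′<k = contradiction (sym e) (<⇒≢ (quotient-< j′ j k′<k))

class : ∀ {n l} → Colouring n l → Fin l → List (Fin n)
class {n} γ i = filter (λ x → γ x Fin.≟ i) (List.allFin n)

module Pairs {L : Language} {n l : ℕ} {κ : Kind} (Ω : List (Structure L n))
  (Ω-unique : Unique (structureSetoid L n) Ω)
  (Ω-complete : ∀ M → Colourable κ l M → Membership._∈_ (structureSetoid L n) M Ω) where

  Pair : Set
  Pair = Structure L n × Vec (Fin l) n

  pairSetoid : Setoid _ _
  pairSetoid = structureSetoid L n ×ₛ setoid (Vec (Fin l) n)

  open Setoid pairSetoid using (_≈_)
  open Membership pairSetoid using () renaming (_∈_ to _∈ₚ_)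

  -- Colourings are vectors here, which gives them propositional equality and a finite enumeration.
  -- The list also holds vectors that do not colour the structure; `RichlyColoured` sorts them out.
  pairs : List Pair
  pairs = cartesianProduct Ω (vectors (List.allFin l) n)

  pairs-unique : Unique pairSetoid pairs
  pairs-unique = UniqueS.cartesianProduct⁺ (structureSetoid L n) (setoid _)
    Ω-unique (vectors-unique (UniqueP.allFin⁺ l) n)

  pairs-complete : ∀ M γ → IsColouring κ M (lookup γ) → (M , γ) ∈ₚ pairs
  pairs-complete M γ c = ∈ₛ.∈-cartesianProduct⁺ (structureSetoid L n) (setoid _)
    (Ω-complete M (lookup γ , c)) (vectors-complete ∈-allFin γ)

  RichlyColoured : ℕ → Pair → Set
  RichlyColoured m (M , γ) = IsColouring κ M (lookup γ) × (∀ i → m ≤ length (class (lookup γ) i))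

  richlyColoured? : ∀ m → Decidable (RichlyColoured m)
  richlyColoured? m (M , γ) = isColouring? κ M (lookup γ) ×-dec Fin.all? λ i → m ≤? length (class (lookup γ) i)

  -- A pattern S with t free vertices and e roots, the latter being sent to ρ. The colouring of S
  -- which the copies of S are to carry may depend on the colouring γ of M.
  module Extension {t e : ℕ} (S : Structure L (t + e)) (ρ : Vec (Fin n) e)
    (σ : Vec (Fin l) n → Colouring (t + e) l) (σ-colours : ∀ γ → IsColouring κ S (σ γ))
    (roots-free : ∀ γ R (v : Vec (Fin (t + e)) (arity L R)) → (∀ i → ∃ λ j → lookup v i ≡ t ↑ʳ j) →
                  ¬ Permitted κ (σ γ) v)
    (d : Fin n) where

    root? : ∀ x → Dec (∃ λ j → lookup ρ j ≡ x)
    root? x = Fin.any? λ j → lookup ρ j Fin.≟ x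

    fresh : Vec (Fin l) n → Fin l → List (Fin n)
    fresh γ i = filter (λ x → (lookup γ x Fin.≟ i) ×-dec ¬? (root? x)) (List.allFin n)

    class-≤-fresh : ∀ γ i → length (class (lookup γ) i) ≤ length (fresh γ i) + e
    class-≤-fresh γ i = ≤-trans (length-filter-∪ (λ x → lookup γ x Fin.≟ i) _ root? split (List.allFin n))
      (+-monoʳ-≤ (length (fresh γ i)) (length-≤-cover (setoid (Fin n))
        (UniqueP.filter⁺ root? (UniqueP.allFin⁺ n)) (lookup ρ)
        (All.map (λ (j , eq) → j , sym eq) (All.all-filter root? (List.allFin n)))))
      where
      split : ∀ {x} → lookup γ x ≡ i → (lookup γ x ≡ i × ¬ (∃ λ j → lookup ρ j ≡ x)) ⊎ (∃ λ j → lookup ρ j ≡ x)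
      split {x} eq with root? x
      ... | yes r = inj₂ r
      ... | no ¬r = inj₁ (eq , ¬r)

    -- Copy `k` reserves the positions from `k * t` to `k * t + t - 1` in the list of every colour,
    -- and vertex `j` takes position `k * t + j` in the list of its own colour. Hence `r * t` fresh
    -- vertices in each class suffice for `r` copies. The places depend on `γ` only, so planting
    -- does not move them.
    place : Vec (Fin l) n → ℕ → Fin t → Fin n
    place γ k j = nth d (fresh γ (σ γ (j ↑ˡ e))) (k * t + toℕ j)

    block : Vec (Fin l) n → ℕ → Vec (Fin n) (t + e)
    block γ k = tabulate (place γ k) ++ ρ

    -- For a pattern whose roots are `a` and `b` and are coloured like `a`, this amounts to `γ`
    -- giving `a` and `b` the same colour.
    Compatible : Vec (Fin l) n → Set
    Compatible γ = ∀ j → σ γ (t ↑ʳ j) ≡ lookup γ (lookup ρ j)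

    Hit : Pair → ℕ → Set
    Hit (M , γ) k = pullback M (block γ k) ≈ˢ S

    hit? : ∀ w k → Dec (Hit w k)
    hit? (M , γ) k = Fin.all? λ R → ∀vec? λ v → _ Bool.≟ _

    lookup-block-free : ∀ γ k j → lookup (block γ k) (j ↑ˡ e) ≡ place γ k j
    lookup-block-free γ k j = trans (lookup-++ˡ (tabulate (place γ k)) ρ j) (lookup∘tabulate (place γ k) j)

    lookup-block-root : ∀ γ k j → lookup (block γ k) (t ↑ʳ j) ≡ lookup ρ j
    lookup-block-root γ k j = lookup-++ʳ (tabulate (place γ k)) ρ j

    data View : Fin (t + e) → Set where
      free : ∀ j → View (j ↑ˡ e)
      root : ∀ j → View (t ↑ʳ j)

    view : ∀ x → View x
    view x with splitAt t x in eq
    ... | inj₁ j = subst View (Fin.splitAt⁻¹-↑ˡ eq) (free j)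
    ... | inj₂ j = subst View (Fin.splitAt⁻¹-↑ʳ eq) (root j)

    Missed : ℕ → ℕ → Pair → Set
    Missed m k w = (RichlyColoured m w × Compatible (proj₂ w)) × (∀ {k′} → k′ < k → ¬ Hit w k′)

    missed? : ∀ m k → Decidable (Missed m k)
    missed? m k w = (richlyColoured? m w ×-dec (Fin.all? λ j → _ Fin.≟ _)) ×-dec
      allUpTo? (λ k′ → ¬? (hit? w k′)) k

    Hit-resp : ∀ {w w′} k → w ≈ w′ → Hit w k → Hit w′ k
    Hit-resp k (M≈M′ , refl) h R v = trans (sym (M≈M′ R _)) (h R v)

    Missed-resp : ∀ m k → Missed m k Respects _≈_
    Missed-resp m k {w} {w′} w≈w′@(M≈M′ , refl) (((c , rich) , compat) , miss) =
      ((IsColouring-resp κ M≈M′ c , rich) , compat) ,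
      λ {k′} k′<k h → miss k′<k (Hit-resp {w′} {w} k′ (Setoid.sym pairSetoid w≈w′) h)

    ¬missed⇒hit : ∀ m k {w} → RichlyColoured m w → Compatible (proj₂ w) → ¬ Missed m k w →
                  ∃ λ k′ → k′ < k × Hit w k′
    ¬missed⇒hit m k {w} coloured compat ¬missed with anyUpTo? (hit? w) k
    ... | yes hit = hit
    ... | no ∄hit = contradiction ((coloured , compat) , λ {k′} k′<k h → ∄hit (k′ , k′<k , h)) ¬missed

    -- Bounds the number of structures that may have stood on a block before planting.
    q : ℕ
    q = length (structures L (t + e))

    instance
      q-nonZero : NonZero q
      q-nonZero = Fin.nonZeroIndex (proj₁ (structures-complete L (t + e) S))

    module _ (ρ-injective : Injective _≡_ _≡_ (lookup ρ)) {m r : ℕ} (rt+e≤m : r * t + e ≤ m) where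

      module _ (γ : Vec (Fin l) n) (rich : ∀ i → m ≤ length (class (lookup γ) i)) where

        position< : ∀ {k} → k < r → ∀ i (j : Fin t) → k * t + toℕ j < length (fresh γ i)
        position< {k} k<r i j = begin-strict
          k * t + toℕ j       <⟨ +-monoʳ-< (k * t) (Fin.toℕ<n j) ⟩
          k * t + t           ≡⟨ +-comm (k * t) t ⟩
          suc k * t           ≤⟨ *-monoˡ-≤ t k<r ⟩
          r * t               ≤⟨ +-cancelʳ-≤ e _ _ (≤-trans rt+e≤m (≤-trans (rich i) (class-≤-fresh γ i))) ⟩
          length (fresh γ i)  ∎
          where open ≤-Reasoning

        place-fresh : ∀ {k} → k < r → ∀ j →
          lookup γ (place γ k j) ≡ σ γ (j ↑ˡ e) × ¬ (∃ λ i → lookup ρ i ≡ place γ k j)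
        place-fresh k<r j = proj₂ (∈-filter⁻ (λ x → (lookup γ x Fin.≟ _) ×-dec ¬? (root? x))
          {xs = List.allFin n} (nth-∈ d (fresh γ _) (position< k<r _ j)))

        -- Equal vertices have equal colours, so both are taken from the same repetition-free list
        -- and their positions agree.
        place-injective : ∀ {k k′} → k < r → k′ < r → ∀ j j′ → place γ k j ≡ place γ k′ j′ → k ≡ k′ × j ≡ j′
        place-injective {k} {k′} k<r k′<r j j′ eq = quotient-unique k k′ j j′
          (nth-injective d (UniqueP.filter⁺ (λ x → (lookup γ x Fin.≟ _) ×-dec ¬? (root? x)) (UniqueP.allFin⁺ n))
            (position< k<r _ j) (position< k′<r _ j′)
            (trans eq (cong (λ i → nth d (fresh γ i) (k′ * t + toℕ j′)) same-colour)))
          where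
          same-colour : σ γ (j′ ↑ˡ e) ≡ σ γ (j ↑ˡ e)
          same-colour = trans (sym (proj₁ (place-fresh k′<r j′)))
            (trans (cong (lookup γ) (sym eq)) (proj₁ (place-fresh k<r j)))

        block-injective : ∀ {k} → k < r → Injective _≡_ _≡_ (lookup (block γ k))
        block-injective {k} k<r {x} {y} eq with view x | view y
        ... | free i | free j = cong (_↑ˡ e) (proj₂ (place-injective k<r k<r i j
          (trans (sym (lookup-block-free γ k i)) (trans eq (lookup-block-free γ k j)))))
        ... | free i | root j = contradiction
          (j , trans (sym (lookup-block-root γ k j)) (trans (sym eq) (lookup-block-free γ k i)))
          (proj₂ (place-fresh k<r i))
        ... | root i | free j = contradiction
          (i , trans (sym (lookup-block-root γ k i)) (trans eq (lookup-block-free γ k j)))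
          (proj₂ (place-fresh k<r j))
        ... | root i | root j = cong (t ↑ʳ_) (ρ-injective
          (trans (sym (lookup-block-root γ k i)) (trans eq (lookup-block-root γ k j))))

        block-disjoint : ∀ {k k′} → k < r → k′ < r → k ≢ k′ → ∀ x y →
          lookup (block γ k) x ≡ lookup (block γ k′) y → ∃ λ j → y ≡ t ↑ʳ j
        block-disjoint {k} {k′} k<r k′<r k≢k′ x y eq with view x | view y
        ... | _      | root j = j , refl
        ... | free i | free j = contradiction (proj₁ (place-injective k<r k′<r i j
          (trans (sym (lookup-block-free γ k i)) (trans eq (lookup-block-free γ k′ j))))) k≢k′
        ... | root i | free j = contradiction
          (i , trans (sym (lookup-block-root γ k i)) (trans eq (lookup-block-free γ k′ j)))
          (proj₂ (place-fresh k′<r j))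

        block-coloured : Compatible γ → ∀ {k} → k < r → ∀ x → lookup γ (lookup (block γ k) x) ≡ σ γ x
        block-coloured compat {k} k<r x with view x
        ... | free i = trans (cong (lookup γ) (lookup-block-free γ k i)) (proj₁ (place-fresh k<r i))
        ... | root i = trans (cong (lookup γ) (lookup-block-root γ k i)) (sym (compat i))

      -- The pairs lost in passing from `Missed m k` to `Missed m (suc k)`.
      FirstHit : ℕ → Pair → Set
      FirstHit k w = Missed m k w × Hit w k

      firstHit? : ∀ k → Decidable (FirstHit k)
      firstHit? k w = missed? m k w ×-dec hit? w k

      FirstHit-resp : ∀ k → FirstHit k Respects _≈_
      FirstHit-resp k {x} {y} x≈y (miss , hit) = Missed-resp m k {x} {y} x≈y miss , Hit-resp {x} {y} k x≈y hit

      plant : ℕ → Pair → Structure L (t + e) → Pair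
      plant k (M , γ) T = override M (block γ k) T , γ

      module _ {M : Structure L n} {γ : Vec (Fin l) n} (c : IsColouring κ M (lookup γ))
               (rich : ∀ i → m ≤ length (class (lookup γ) i)) (compat : Compatible γ) where

        plant-IsColouring : ∀ {k} → k < r → IsColouring κ (override M (block γ k) S) (lookup γ)
        plant-IsColouring {k} k<r = isColouring κ helper
          where
          helper : ∀ R v → rel (override M (block γ k) S) R v ≡ true → Permitted κ (lookup γ) v
          helper R v related with preimage? (lookup (block γ k)) v
          ... | yes (u , refl) = Permitted-∘ κ (block-coloured γ rich compat k<r)
                                   (related⇒permitted κ (σ-colours γ) R u related)
          ... | no _           = related⇒permitted κ c R v related

        -- Distinct blocks meet only in the roots, and tuples of roots are unrelated in M and in S.
        plant-Hit⁻ : ∀ {k k′} → k < r → k′ < r → k ≢ k′ → Hit (plant k (M , γ) S) k′ → Hit (M , γ) k′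
        plant-Hit⁻ {k} {k′} k<r k′<r k≢k′ hit R v
          with preimage? (lookup (block γ k)) (map (lookup (block γ k′)) v)
        ... | no ∄u = trans (sym (override-outside {M = M} {block γ k} {S} R _ ∄u)) (hit R v)
        ... | yes (u , e) = trans
          (Bool.¬-not (¬permitted ∘ Permitted-∘⁻ κ (block-coloured γ rich compat k′<r) ∘
            related⇒permitted κ c R _))
          (sym (Bool.¬-not (¬permitted ∘ related⇒permitted κ (σ-colours γ) R v)))
          where
          ¬permitted : ¬ Permitted κ (σ γ) v
          ¬permitted = roots-free γ R v λ i → block-disjoint γ rich k<r k′<r k≢k′ (lookup u i) (lookup v i)
            (trans (sym (lookup-map i _ u)) (trans (cong (λ w → lookup w i) e) (lookup-map i _ v)))

      missedCount : ℕ → ℕ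
      missedCount k = length (filter (missed? m k) pairs)

      -- Planting `S` at block `k` turns a pair missed so far into a first hit. Replanting the
      -- former structure of the block restores the pair, so at most `q` pairs lead to the same
      -- first hit.
      missed-≤-firstHit : ∀ {k} → k < r → missedCount k ≤ length (filter (firstHit? k) pairs) * q
      missed-≤-firstHit {k} k<r = length-≤-cover₂ pairSetoid
        (UniqueS.filter⁺ pairSetoid (missed? m k) pairs-unique)
        (λ i j → plant k (List.lookup (filter (firstHit? k) pairs) i) (List.lookup (structures L (t + e)) j))
        (All.map (λ {w} → cover {w}) (All.all-filter (missed? m k) pairs))
        where
        cover : ∀ {w} → Missed m k w → ∃ λ i → ∃ λ j →
          w ≈ plant k (List.lookup (filter (firstHit? k) pairs) i) (List.lookup (structures L (t + e)) j)
        cover {M , γ} (((c , rich) , compat) , miss) = index w′∈ , j , restored (lookup-index w′∈)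
          where
          ε = block γ k
          c′ = plant-IsColouring {M} c rich compat k<r
          w′∈ : plant k (M , γ) S ∈ₚ filter (firstHit? k) pairs
          w′∈ = ∈ₛ.∈-filter⁺ pairSetoid (firstHit? k) (λ {x} {y} → FirstHit-resp k {x} {y})
            (pairs-complete _ γ c′)
            -- Planting keeps `γ`, hence richness and compatibility; an earlier block that is hit
            -- after planting would have been hit before.
            ((((c′ , rich) , compat) ,
              λ k′<k → miss k′<k ∘ plant-Hit⁻ {M} c rich compat k<r (<-trans k′<k k<r) (>⇒≢ k′<k)) ,
             override-inside {M = M} (block-injective γ rich k<r))
          j = proj₁ (structures-complete L (t + e) (pullback M ε))
          T = List.lookup (structures L (t + e)) j
          -- The list contains the planted pair only up to `≈`, and `override-cong` carries the
          -- restoration over to the listed representative.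
          restored : ∀ {w″} → plant k (M , γ) S ≈ w″ → (M , γ) ≈ plant k w″ T
          restored (≈M , refl) = (λ R v → trans
            (override-restore {M = M} ε S T (proj₂ (structures-complete L (t + e) (pullback M ε))) R v)
            (override-cong ε T ≈M R v)) , refl

      -- At least one in `q` of the pairs missed so far is accounted for by a first hit at block
      -- `k`, and first hits are no longer missed afterwards.
      missed-step : ∀ k → k < r → q * missedCount (suc k) + missedCount k ≤ q * missedCount k
      missed-step k k<r = begin
        q * missedCount (suc k) + missedCount k
          ≤⟨ +-monoʳ-≤ (q * missedCount (suc k)) (missed-≤-firstHit k<r) ⟩
        q * missedCount (suc k) + h * q
          ≡⟨ cong (q * missedCount (suc k) +_) (*-comm h q) ⟩
        q * missedCount (suc k) + q * h
          ≡⟨ *-distribˡ-+ q (missedCount (suc k)) h ⟨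
        q * (missedCount (suc k) + h)
          ≤⟨ *-monoʳ-≤ q (length-filter-⊎ (missed? m k) (missed? m (suc k)) (firstHit? k)
               (λ {w} → later {w}) (λ {w} → proj₁) pairs) ⟩
        q * missedCount k ∎
        where
        open ≤-Reasoning
        h = length (filter (firstHit? k) pairs)
        later : ∀ {w} → Missed m (suc k) w → Missed m k w × ¬ FirstHit k w
        later {w} (K , miss) = (K , λ {k′} k′<k → miss (m<n⇒m<1+n k′<k)) , λ (_ , hit) → miss (n<1+n k) hit

    -- `j` halvings consume `j * q` blocks; each class has to supply `t` vertices per block, apart
    -- from the at most `e` roots it may contain.
    missed-bound : Injective _≡_ _≡_ (lookup ρ) → ∀ j {m} → j * q * t + e ≤ m →
      2 ^ j * length (filter (missed? m (j * q)) pairs) ≤ length (filter (richlyColoured? m) pairs)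
    missed-bound ρ-injective j {m} le = ≤-trans
      (halving-iterated q j (missedCount ρ-injective {r = j * q} le) (missed-step ρ-injective {r = j * q} le))
      (length-filter-⊆ (missed? m 0) (richlyColoured? m) (λ {w} → proj₁ ∘ proj₁) pairs)

-- Complete structures

transpose-left : ∀ (i j : Fin n) → PC.transpose i j i ≡ j
transpose-left i j with i Fin.≟ i
... | yes _  = refl
... | no i≢i = contradiction refl i≢i

transpose-other : ∀ {i j k : Fin n} → k ≢ i → k ≢ j → PC.transpose i j k ≡ k
transpose-other {i = i} {j} {k} k≢i k≢j with k Fin.≟ i
... | yes k≡i = contradiction k≡i k≢i
... | no _ with k Fin.≟ j
...   | yes k≡j = contradiction k≡j k≢j
...   | no _    = refl

transpose-injective : ∀ (i j : Fin n) → Injective _≡_ _≡_ (PC.transpose i j)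
transpose-injective i j {x} {y} e = trans (sym (PC.transpose-inverse j i))
  (trans (cong (PC.transpose j i) e) (PC.transpose-inverse j i))

-- The first transposition takes `p` to `i`. The second takes the image of `p′` to `j` and fixes
-- `i`, which differs from both points it moves.
two-transitive : ∀ {p p′ i j : Fin n} → p ≢ p′ → i ≢ j →
                 ∃ λ (f : Fin n → Fin n) → Injective _≡_ _≡_ f × f p ≡ i × f p′ ≡ j
two-transitive {p = p} {p′} {i} {j} p≢p′ i≢j =
  PC.transpose u j ∘ PC.transpose p i ,
  transpose-injective p i ∘ transpose-injective u j ,
  trans (cong (PC.transpose u j) (transpose-left p i)) (transpose-other i≢u i≢j) ,
  transpose-left u j
  where
  u = PC.transpose p i p′
  i≢u : i ≢ u
  i≢u e = p≢p′ (transpose-injective p i (trans (transpose-left p i) e))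

injective⇒surjective : ∀ {f : Fin n → Fin n} → Injective _≡_ _≡_ f → ∀ y → ∃ λ x → f x ≡ y
injective⇒surjective {suc n} {f} inj y with Fin.any? (λ x → f x Fin.≟ y)
... | yes x = x
... | no ∄x = contradiction (Fin.injective⇒≤ {f = λ x → punchOut (y≢f x)}
    (λ {a} {b} → inj ∘ Fin.punchOut-injective (y≢f a) (y≢f b))) (<⇒≱ (n<1+n n))
  where
  y≢f : ∀ x → y ≢ f x
  y≢f x e = ∄x (x , sym e)

injective⇒permutation : ∀ {f : Fin n → Fin n} → Injective _≡_ _≡_ f →
                        ∃ λ (π : Permutation′ n) → ∀ x → π ⟨$⟩ʳ x ≡ f x
injective⇒permutation {f = f} inj =
  permutation f (proj₁ ∘ surj) (proj₂ ∘ surj) (λ x → inj (proj₂ (surj (f x)))) , λ _ → refl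
  where surj = injective⇒surjective inj

-- The analogue of a complete multipartite hypergraph: each relation is as large as `τ` allows.
complete : ∀ {L} κ → (Fin s → Fin l) → Structure L s
complete κ τ = record { rel = λ R v → does (permitted? κ τ v) }

complete⁻ : ∀ {L} κ (τ : Fin s → Fin l) → IsColouring {L} κ (complete κ τ) τ
complete⁻ {L = L} κ τ = isColouring κ helper
  where
  helper : ∀ R v → rel (complete {L = L} κ τ) R v ≡ true → Permitted κ τ v
  helper R v related with permitted? κ τ v
  helper R v _  | yes p = p
  helper R v () | no _

-- Entries of a related tuple have pairwise different colours under a strong colouring. A symbol of
-- arity above `l` would therefore hold of no tuple and could not tell vertices apart.
Admissible : Kind → Language → ℕ → Set
Admissible weak   L l = ⊤
Admissible strong L l = ∀ R → arity L R ≤ l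

-- The tuple is the edge between x and y: for weak colourings (x, y, …, y), for strong
-- colourings an injectively coloured tuple through x and y.
separator : ∀ κ (τ : Fin s → Fin l) → (κ ≡ strong → m ≤ l) → (∀ c → ∃ λ x → τ x ≡ c) → 2 ≤ m →
  ∀ {x y} → τ x ≢ τ y →
  ∃ λ (v : Vec (Fin s) m) → Permitted κ τ v × (∀ {l′} (δ : Colouring s l′) → δ x ≡ δ y → ¬ Permitted κ δ v)
separator weak τ _ _ 2≤m@(s≤s {n = suc m} (s≤s _)) {x} {y} τx≢τy =
  x ∷ replicate (suc m) y , (zero , suc zero , τx≢τy) , λ δ δx≡δy →
    let all-y : ∀ i → δ (lookup (x ∷ replicate (suc m) y) i) ≡ δ y
        all-y = λ { zero → δx≡δy ; (suc i) → cong δ (lookup-replicate i y) }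
    in monochromatic⇒¬permitted weak {γ = δ} {v = x ∷ replicate (suc m) y} 2≤m λ i j →
          trans (all-y i) (sym (all-y j))
separator {s} {l} {m} strong τ m≤l′ surj (s≤s (s≤s _)) {x} {y} τx≢τy =
  tabulate at , (λ i j i≢j e → i≢j (Fin.inject≤-injective m≤l m≤l i j (π-injective (at-colour i j e)))) ,
  λ δ δx≡δy p → p zero (suc zero) (λ ()) (trans (cong δ (trans (cong vertex π0) vertex-x))
    (trans δx≡δy (cong δ (sym (trans (cong vertex π1) vertex-y)))))
  where
  m≤l = m≤l′ refl
  -- A section of `τ` chosen to pass through `x` and `y`.
  vertex : Fin l → Fin s
  vertex c with c Fin.≟ τ x | c Fin.≟ τ y
  ... | yes _ | _     = x
  ... | no _  | yes _ = y
  ... | no _  | no _  = proj₁ (surj c)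
  τ-vertex : ∀ c → τ (vertex c) ≡ c
  τ-vertex c with c Fin.≟ τ x | c Fin.≟ τ y
  ... | yes e | _     = sym e
  ... | no _  | yes e = sym e
  ... | no _  | no _  = proj₂ (surj c)
  vertex-x : vertex (τ x) ≡ x
  vertex-x with τ x Fin.≟ τ x | τ x Fin.≟ τ y
  ... | yes _ | _ = refl
  ... | no ≢  | _ = contradiction refl ≢
  vertex-y : vertex (τ y) ≡ y
  vertex-y with τ y Fin.≟ τ x | τ y Fin.≟ τ y
  ... | yes e | _     = contradiction (sym e) τx≢τy
  ... | no _  | yes _ = refl
  ... | no _  | no ≢  = contradiction refl ≢
  positions≢ : inject≤ {m} zero m≤l ≢ inject≤ (suc zero) m≤l
  positions≢ e with () ← Fin.inject≤-injective m≤l m≤l zero (suc zero) e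
  -- Permuting the colours puts `τ x` and `τ y` at the first two positions of the tuple.
  πs = two-transitive positions≢ τx≢τy
  π : Fin l → Fin l
  π = proj₁ πs
  π-injective : Injective _≡_ _≡_ π
  π-injective = proj₁ (proj₂ πs)
  π0 = proj₁ (proj₂ (proj₂ πs))
  π1 = proj₂ (proj₂ (proj₂ πs))
  at : Fin m → Fin s
  at i = vertex (π (inject≤ i m≤l))
  at-colour : ∀ i j → τ (lookup (tabulate at) i) ≡ τ (lookup (tabulate at) j) →
              π (inject≤ i m≤l) ≡ π (inject≤ j m≤l)
  at-colour i j e rewrite lookup∘tabulate at i | lookup∘tabulate at j =
    trans (sym (τ-vertex _)) (trans e (τ-vertex _))

symbol : ∀ L → Symbol L
symbol L = fromℕ< (Language.nonempty L)

admissible⇒arity≤ : ∀ κ → Admissible κ L l → ∀ R → κ ≡ strong → arity L R ≤ l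
admissible⇒arity≤ strong adm R refl = adm R

-- `separator` provides a tuple that is related in `complete κ τ` but not permitted by any colouring
-- identifying `x` and `y`. It is taken for one symbol, which `nonempty` supplies.
complete-separates : ∀ {L} κ → Admissible κ L l → (τ : Fin s → Fin l) → (∀ c → ∃ λ x → τ x ≡ c) →
  ∀ {δ : Colouring s l′} → IsColouring {L} κ (complete κ τ) δ → ∀ {x y} → δ x ≡ δ y → τ x ≡ τ y
complete-separates {L = L} κ adm τ surj {δ} c {x} {y} δx≡δy with τ x Fin.≟ τ y
... | yes e = e
... | no ≢ =
  let (v , permitted , separates) =
        separator κ τ (admissible⇒arity≤ κ adm (symbol L)) surj (Language.arity≥2 L (symbol L)) ≢
  in contradiction (related⇒permitted κ c (symbol L) v (dec-true (permitted? κ τ v) permitted))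
       (separates δ δx≡δy)

-- An instance of 𝒮: one vertex for each colour but the last, and two of the last colour.
gadgetColouring : ∀ l → Colouring (l + 2) (suc l)
gadgetColouring l x with splitAt l x
... | inj₁ i = inject₁ i
... | inj₂ _ = fromℕ l

module _ (l : ℕ) where

  private
    τ = gadgetColouring l

  gadget-surjective : ∀ c → ∃ λ x → τ x ≡ c
  gadget-surjective c with c Fin.≟ fromℕ l
  ... | yes refl = l ↑ʳ zero , last
    where
    last : τ (l ↑ʳ zero) ≡ fromℕ l
    last rewrite Fin.splitAt-↑ʳ l 2 zero = refl
  ... | no c≢l = i ↑ˡ 2 , below
    where
    l≢c : l ≢ toℕ c
    l≢c e = c≢l (Fin.toℕ-injective (trans (sym e) (sym (Fin.toℕ-fromℕ l))))
    i = lower₁ c l≢c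
    below : τ (i ↑ˡ 2) ≡ c
    below rewrite Fin.splitAt-↑ˡ l i 2 = Fin.inject₁-lower₁ c l≢c

  gadget-collision : ∀ {x y} → x Fin.< y → τ x ≡ τ y → x ≡ penultimate l × y ≡ ultimate l
  gadget-collision {x} {y} x<y e with splitAt l x in eqx | splitAt l y in eqy
  ... | inj₁ i | inj₁ j = contradiction (trans (sym (Fin.splitAt⁻¹-↑ˡ eqx))
      (trans (cong (_↑ˡ 2) (Fin.inject₁-injective e)) (Fin.splitAt⁻¹-↑ˡ eqy))) (Fin.<⇒≢ x<y)
  ... | inj₁ i | inj₂ j = contradiction (sym e) Fin.fromℕ≢inject₁
  ... | inj₂ i | inj₁ j = contradiction e Fin.fromℕ≢inject₁
  ... | inj₂ zero       | inj₂ (suc zero) = sym (Fin.splitAt⁻¹-↑ʳ eqx) , sym (Fin.splitAt⁻¹-↑ʳ eqy)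
  ... | inj₂ zero       | inj₂ zero       = contradiction
      (trans (sym (Fin.splitAt⁻¹-↑ʳ eqx)) (Fin.splitAt⁻¹-↑ʳ eqy)) (Fin.<⇒≢ x<y)
  ... | inj₂ (suc zero) | inj₂ (suc zero) = contradiction
      (trans (sym (Fin.splitAt⁻¹-↑ʳ eqx)) (Fin.splitAt⁻¹-↑ʳ eqy)) (Fin.<⇒≢ x<y)
  ... | inj₂ (suc zero) | inj₂ zero       = contradiction
      (subst₂ Fin._<_ (sym (Fin.splitAt⁻¹-↑ʳ eqx)) (sym (Fin.splitAt⁻¹-↑ʳ eqy)) x<y)
      (<-asym (subst₂ _<_ (sym (Fin.toℕ-↑ʳ l zero)) (sym (Fin.toℕ-↑ʳ l (suc zero))) (+-monoʳ-< l (s≤s z≤n))))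

  gadget-last : ∀ j → τ (l ↑ʳ j) ≡ fromℕ l
  gadget-last j rewrite Fin.splitAt-↑ʳ l 2 j = refl

  -- There is one more vertex than there are colours, so any colouring identifies two vertices. By
  -- `complete-separates` these also agree under `τ`, and only the last two vertices do. Transposing
  -- colours gives that pair any prescribed colour.
  gadget-forces : ∀ {L} κ → Admissible κ L (suc l) → 1 ≤ l → ForcesEqualColours {L} κ (suc l) (complete κ τ)
  gadget-forces {L} κ adm 1≤l = record
    { s≥3        = +-monoˡ-≤ 2 1≤l
    ; colourable = τ , complete⁻ κ τ
    ; forced     = λ δ c → forced δ c (Fin.pigeonhole (≤-reflexive (+-comm 2 l)) δ)
    ; attained   = λ i → PC.transpose (fromℕ l) i ∘ τ ,
        isColouring {L = L} κ {M = complete κ τ} (λ R v r →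
          Permitted-refine κ {v = v} {v} (λ _ _ → transpose-injective (fromℕ l) i)
          (related⇒permitted κ (complete⁻ {L = L} κ τ) R v r)) ,
        at i zero , at i (suc zero)
    }
    where
    forced : ∀ δ → IsColouring κ (complete κ τ) δ → (∃₂ λ x y → x Fin.< y × δ x ≡ δ y) →
             δ (penultimate l) ≡ δ (ultimate l)
    forced δ c (x , y , x<y , e)
      with refl , refl ← gadget-collision x<y (complete-separates κ adm τ gadget-surjective c e) = e
    at : ∀ i j → PC.transpose (fromℕ l) i (τ (l ↑ʳ j)) ≡ i
    at i j = trans (cong (PC.transpose (fromℕ l) i) (gadget-last j)) (transpose-left (fromℕ l) i)

-- Counting rigid structures

module _ {L : Language} {t : ℕ} {κ : Kind} {l : ℕ} {S : Structure L (t + 2)} where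

  IsIsomorphism⇒≡ : ForcesEqualColours κ l S → ∀ {n} {M : Structure L n} {us a b} →
    IsIsomorphism M (us ++ a ∷ b ∷ []) S → ∀ {δ : Colouring n l} → IsColouring κ M δ → δ a ≡ δ b
  IsIsomorphism⇒≡ forces {us = us} {a} {b} iso {δ} c =
    trans (cong δ (sym (lookup-++ʳ us _ zero)))
      (trans (ForcesEqualColours.forced forces _
                (pullback-IsColouring κ (us ++ a ∷ b ∷ []) (IsIsomorphism.preserves iso) c))
        (cong δ (lookup-++ʳ us _ (suc zero))))

  -- The common source of definability and uniqueness. `linked` makes every colouring constant on
  -- the classes of `γ`, and `separated` keeps different classes apart.
  record Rigid {n} (M : Structure L n) : Set where
    field
      γ          : Colouring n l
      γ-colours  : IsColouring κ M γ
      linked     : ∀ {a b} → a ≢ b → γ a ≡ γ b → ∃ λ us → IsIsomorphism M (us ++ a ∷ b ∷ []) S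
      separated  : ∀ {δ : Colouring n l} → IsColouring κ M δ → ∀ {a b} → δ a ≡ δ b → γ a ≡ γ b
      attained   : ∀ i → ∃ λ a → γ a ≡ i

pair-injective : ∀ {A : Set} {a b : A} → a ≢ b → Injective _≡_ _≡_ (lookup (a ∷ b ∷ []))
pair-injective a≢b {zero}     {zero}     _ = refl
pair-injective a≢b {zero}     {suc zero} e = contradiction e a≢b
pair-injective a≢b {suc zero} {zero}     e = contradiction (sym e) a≢b
pair-injective a≢b {suc zero} {suc zero} _ = refl

nil-injective : ∀ {A : Set} → Injective _≡_ _≡_ (lookup {A = A} [])
nil-injective {x = x} = contradiction x Fin.¬Fin0

-- A colour that `δ` never takes is sent to itself, an arbitrary choice. The map is a vector so that
-- it occurs in a finite list.
factor : ∀ {n l} (δ γ : Colouring n l) → (∀ {a b} → δ a ≡ δ b → γ a ≡ γ b) →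
         ∃ λ (π : Vec (Fin l) l) → ∀ a → lookup π (δ a) ≡ γ a
factor {l = l} δ γ δ⇒γ = tabulate π , λ a → trans (lookup∘tabulate π (δ a)) (π-δ a)
  where
  π : Fin l → Fin l
  π c with Fin.any? (λ a → δ a Fin.≟ c)
  ... | yes (a , _) = γ a
  ... | no _        = c
  π-δ : ∀ a → π (δ a) ≡ γ a
  π-δ a with Fin.any? (λ b → δ b Fin.≟ δ a)
  ... | yes (b , e) = δ⇒γ e
  ... | no ∄        = contradiction (a , refl) ∄

module RigidCount {L : Language} {n l : ℕ} {κ : Kind} (Ω : List (Structure L n))
  (Ω-unique : Unique (structureSetoid L n) Ω)
  (Ω-sound : All (Colourable κ l) Ω)
  (Ω-complete : ∀ M → Colourable κ l M → Membership._∈_ (structureSetoid L n) M Ω)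
  (admissible : Admissible κ L l) {t : ℕ} {S : Structure L (t + 2)} (forces : ForcesEqualColours κ l S)
  (d : Fin n) where

  open Pairs Ω Ω-unique Ω-complete public
  open Setoid pairSetoid using (_≈_)

  -- The identity on colours; the form `l + 0` is that of a pattern with `l` free vertices and no
  -- roots.
  τ : Fin (l + 0) → Fin l
  τ = cast (+-identityʳ l)

  τ-↑ˡ : ∀ i → τ (i ↑ˡ 0) ≡ i
  τ-↑ˡ i = Fin.toℕ-injective (trans (Fin.toℕ-cast _ (i ↑ˡ 0)) (Fin.toℕ-↑ˡ i 0))

  -- Taken from `attained`, because the common colour of the two roots has to follow the colour of
  -- `a` under `γ`.
  σ : Fin n → Vec (Fin l) n → Colouring (t + 2) l
  σ a γ = proj₁ (ForcesEqualColours.attained forces (lookup γ a))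

  σ-root : ∀ a γ j → σ a γ (t ↑ʳ j) ≡ lookup γ a
  σ-root a γ zero       = proj₁ (proj₂ (proj₂ (ForcesEqualColours.attained forces (lookup γ a))))
  σ-root a γ (suc zero) = proj₂ (proj₂ (proj₂ (ForcesEqualColours.attained forces (lookup γ a))))

  σ-roots-free : ∀ a γ R (v : Vec (Fin (t + 2)) (arity L R)) → (∀ i → ∃ λ j → lookup v i ≡ t ↑ʳ j) →
                 ¬ Permitted κ (σ a γ) v
  σ-roots-free a γ R v roots = monochromatic⇒¬permitted κ {v = v} (Language.arity≥2 L R)
    λ i j → trans (root (roots i)) (sym (root (roots j)))
    where
    root : ∀ {x} → (∃ λ j → x ≡ t ↑ʳ j) → σ a γ x ≡ lookup γ a
    root (j , refl) = σ-root a γ j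

  module Link (a b : Fin n) = Extension S (a ∷ b ∷ []) (σ a)
    (λ γ → proj₁ (proj₂ (ForcesEqualColours.attained forces (lookup γ a))))
    (σ-roots-free a) d

  -- One vertex for each colour. Tuples of roots are excluded vacuously, as a tuple has an entry and
  -- there are no roots.
  module Span = Extension {e = 0} (complete κ τ) [] (λ _ → τ) (λ _ → complete⁻ κ τ)
    (λ _ R v roots → contradiction (proj₁ (roots (inject≤ zero (Language.arity≥2 L R)))) Fin.¬Fin0) d

  qₗ qₛ : ℕ
  qₗ = length (structures L (t + 2))
  qₛ = length (structures L (l + 0))

  -- Classes of size `m` leave room for `j` halvings with either pattern; the summand 2 accounts for
  -- the roots of `Link`.
  module _ (j : ℕ) {m : ℕ} (j-fits : j * (qₗ * t + qₛ * l) + 2 ≤ m) where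

    -- `Missed` includes `Compatible`, so `a` and `b` have the same colour here; their being
    -- distinct makes the root map injective.
    Unlinked : Fin n → Fin n → Pair → Set
    Unlinked a b w = a ≢ b × Link.Missed a b m (j * qₗ) w

    unlinked? : ∀ a b → Decidable (Unlinked a b)
    unlinked? a b w = ¬? (a Fin.≟ b) ×-dec Link.missed? a b m (j * qₗ) w

    Bad : Pair → Set
    Bad w = Span.Missed m (j * qₛ) w ⊎ ∃₂ λ a b → Unlinked a b w

    someUnlinked? : Decidable (λ w → ∃₂ λ a b → Unlinked a b w)
    someUnlinked? w = Fin.any? λ a → Fin.any? λ b → unlinked? a b w

    bad? : Decidable Bad
    bad? w = Span.missed? m (j * qₛ) w ⊎-dec someUnlinked? w

    Bad-resp : Bad Respects _≈_
    Bad-resp {x} {y} x≈y (inj₁ missed)                  = inj₁ (Span.Missed-resp m (j * qₛ) {x} {y} x≈y missed)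
    Bad-resp {x} {y} x≈y (inj₂ (a , b , a≢b , missed)) =
      inj₂ (a , b , a≢b , Link.Missed-resp a b m (j * qₗ) {x} {y} x≈y missed)

    W : ℕ
    W = length (filter (richlyColoured? m) pairs)

    links-fit : j * qₗ * t + 2 ≤ m
    links-fit = begin
      j * qₗ * t + 2                ≡⟨ cong (_+ 2) (*-assoc j qₗ t) ⟩
      j * (qₗ * t) + 2              ≤⟨ +-monoˡ-≤ 2 (*-monoʳ-≤ j (m≤m+n _ _)) ⟩
      j * (qₗ * t + qₛ * l) + 2     ≤⟨ j-fits ⟩
      m                             ∎
      where open ≤-Reasoning

    spans-fit : j * qₛ * l + 0 ≤ m
    spans-fit = begin
      j * qₛ * l + 0                ≡⟨ +-identityʳ _ ⟩
      j * qₛ * l                    ≡⟨ *-assoc j qₛ l ⟩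
      j * (qₛ * l)                  ≤⟨ *-monoʳ-≤ j (m≤n+m _ _) ⟩
      j * (qₗ * t + qₛ * l)         ≤⟨ m≤m+n _ _ ⟩
      j * (qₗ * t + qₛ * l) + 2     ≤⟨ j-fits ⟩
      m                             ∎
      where open ≤-Reasoning

    unlinked-bound : ∀ a b → 2 ^ j * length (filter (unlinked? a b) pairs) ≤ W
    unlinked-bound a b = bound (a Fin.≟ b)
      where
      bound : Dec (a ≡ b) → 2 ^ j * length (filter (unlinked? a b) pairs) ≤ W
      bound (yes a≡b) = ≤-trans (≤-reflexive (trans (cong (λ ws → 2 ^ j * length ws)
          (List.filter-none (unlinked? a b) {pairs} (All.universal (λ _ (a≢b , _) → a≢b a≡b) pairs)))
          (*-zeroʳ (2 ^ j)))) z≤n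
      bound (no a≢b) = ≤-trans
        (*-monoʳ-≤ (2 ^ j) (length-filter-⊆ (unlinked? a b) (Link.missed? a b m (j * qₗ))
          (λ {w} → proj₂) pairs))
        (Link.missed-bound a b (pair-injective a≢b) j links-fit)

    unspanned-bound : 2 ^ j * length (filter (Span.missed? m (j * qₛ)) pairs) ≤ W
    unspanned-bound = Span.missed-bound nil-injective j spans-fit

    -- A union bound over one event for `Span` and `n * n` events for `Link`.
    bad-bound : 2 ^ j * length (filter bad? pairs) ≤ (1 + n * n) * W
    bad-bound = begin
      2 ^ j * length (filter bad? pairs)
        ≤⟨ *-monoʳ-≤ (2 ^ j) (length-filter-∪ bad? (Span.missed? m (j * qₛ)) someUnlinked? id pairs) ⟩
      2 ^ j * (length (filter (Span.missed? m (j * qₛ)) pairs) + length (filter someUnlinked? pairs))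
        ≡⟨ *-distribˡ-+ (2 ^ j) _ _ ⟩
      2 ^ j * length (filter (Span.missed? m (j * qₛ)) pairs) + 2 ^ j * length (filter someUnlinked? pairs)
        ≤⟨ +-mono-≤ unspanned-bound
             (union-bound (λ a w → Fin.any? λ b → unlinked? a b w) someUnlinked? id pairs (2 ^ j) (n * W)
             λ a → union-bound (unlinked? a) _ id pairs (2 ^ j) W (unlinked-bound a)) ⟩
      W + n * (n * W)
        ≡⟨ cong (W +_) (*-assoc n n W) ⟨
      W + n * n * W ∎
      where open ≤-Reasoning

    Good : Pair → Set
    Good w = RichlyColoured m w × ¬ Bad w

    good? : Decidable Good
    good? w = richlyColoured? m w ×-dec ¬? (bad? w)

    link : ∀ M γ → Good (M , γ) → ∀ {a b} → a ≢ b → lookup γ a ≡ lookup γ b →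
           ∃ λ us → IsIsomorphism M (us ++ a ∷ b ∷ []) S
    link M γ (coloured , ¬bad) {a} {b} a≢b γa≡γb
      with Link.¬missed⇒hit a b m (j * qₗ) {M , γ} coloured compatible
             (λ missed → ¬bad (inj₂ (a , b , a≢b , missed)))
      where
      compatible : ∀ i → σ a γ (t ↑ʳ i) ≡ lookup γ (lookup (a ∷ b ∷ []) i)
      compatible zero       = σ-root a γ zero
      compatible (suc zero) = trans (σ-root a γ (suc zero)) γa≡γb
    ... | k , k< , hit = tabulate (Link.place a b γ k) , record
      { distinct  = Link.block-injective a b (pair-injective a≢b) {r = j * qₗ} links-fit γ (proj₂ coloured) k<
      ; preserves = hit
      }

    -- A hit of `Span` is a transversal of the classes of `γ`, and `complete-separates` makes every
    -- colouring of `M` injective on it.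
    span : ∀ M γ → Good (M , γ) → ∃ λ (ε : Fin l → Fin n) → (∀ i → lookup γ (ε i) ≡ i) ×
           (∀ {δ : Colouring n l} → IsColouring κ M δ → ∀ {i i′} → δ (ε i) ≡ δ (ε i′) → i ≡ i′)
    span M γ (coloured , ¬bad)
      with Span.¬missed⇒hit m (j * qₛ) {M , γ} coloured (λ i → contradiction i Fin.¬Fin0) (¬bad ∘ inj₁)
    ... | k , k< , hit = (λ i → lookup (Span.block γ k) (i ↑ˡ 0)) ,
      (λ i → trans (Span.block-coloured nil-injective {r = j * qₛ} spans-fit γ (proj₂ coloured)
                      (λ i → contradiction i Fin.¬Fin0) k< (i ↑ˡ 0))
                    (τ-↑ˡ i)) ,
      λ cδ {i} {i′} e → trans (sym (τ-↑ˡ i)) (trans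
        (complete-separates κ admissible τ (λ c → c ↑ˡ 0 , τ-↑ˡ c)
          (pullback-IsColouring κ (Span.block γ k) hit cδ) e)
        (τ-↑ˡ i′))

    -- Any colouring `δ` gives `a` the colour of the representative `ε` of its `γ`-class, since the
    -- two are equal or linked. As `δ` is injective on representatives, its equalities are
    -- equalities of `γ`.
    good⇒rigid : ∀ M γ → Good (M , γ) → Rigid {κ = κ} {l} {S} M
    good⇒rigid M γ good@((c , rich) , ¬bad) = record
      { γ         = lookup γ
      ; γ-colours = c
      ; linked    = link M γ good
      ; separated = λ cδ {a} {b} δa≡δb → ε-separated cδ
          (trans (sym (to-ε cδ a)) (trans δa≡δb (to-ε cδ b)))
      ; attained  = λ i → ε i , γ∘ε i
      }
      where
      ε = proj₁ (span M γ good)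
      γ∘ε = proj₁ (proj₂ (span M γ good))
      ε-separated : ∀ {δ : Colouring n l} → IsColouring κ M δ → ∀ {i i′} → δ (ε i) ≡ δ (ε i′) → i ≡ i′
      ε-separated = proj₂ (proj₂ (span M γ good))
      to-ε : ∀ {δ : Colouring n l} → IsColouring κ M δ → ∀ a → δ a ≡ δ (ε (lookup γ a))
      to-ε {δ} cδ a with a Fin.≟ ε (lookup γ a)
      ... | yes e = cong δ e
      ... | no a≢ = IsIsomorphism⇒≡ forces (proj₂ (link M γ good a≢ (sym (γ∘ε (lookup γ a))))) cδ

    -- Fix one colouring `δ` of each structure in `Ω`. A good `γ` on the same structure factors
    -- through it, so `γ` is determined by a map from colours to colours.
    good-bound : length (filter good? pairs) ≤ length Ω * length (vectors (List.allFin l) l)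
    good-bound = length-≤-cover₂ pairSetoid (UniqueS.filter⁺ pairSetoid good? pairs-unique) recolour
      (All.tabulate cover)
      where
      δ : Fin (length Ω) → Colouring n l
      δ i = proj₁ (All.lookup Ω-sound (∈-lookup i))
      recolour : Fin (length Ω) → Fin (length (vectors (List.allFin l) l)) → Pair
      recolour i k = List.lookup Ω i , tabulate (λ a → lookup (List.lookup (vectors (List.allFin l) l) k) (δ i a))
      cover : ∀ {w} → w ∈ filter good? pairs → ∃₂ λ i k → w ≈ recolour i k
      cover {M , γ} w∈ = i , index π∈ , (λ R v → cong (λ M → rel M R v) (lookup-index M∈)) ,
        trans (sym (tabulate∘lookup γ)) (tabulate-cong λ a →
          trans (sym (π-δ a)) (cong (λ v → lookup v (δ i a)) (lookup-index π∈)))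
        where
        M∈ : M ∈ Ω
        M∈ = proj₁ (∈-cartesianProduct⁻ Ω (vectors (List.allFin l) n) (proj₁ (∈-filter⁻ good? {xs = pairs} w∈)))
        good = proj₂ (∈-filter⁻ good? {xs = pairs} w∈)
        i = index M∈
        δ-colours : IsColouring κ M (δ i)
        δ-colours = subst (λ M → IsColouring κ M (δ i)) (sym (lookup-index M∈))
          (proj₂ (All.lookup Ω-sound (∈-lookup i)))
        factored = factor (δ i) (lookup γ) (Rigid.separated (good⇒rigid M γ good) δ-colours)
        π = proj₁ factored
        π-δ = proj₂ factored
        π∈ : π ∈ vectors (List.allFin l) l
        π∈ = vectors-complete ∈-allFin π

    RichBad : Pair → Set
    RichBad w = RichlyColoured m w × Bad w

    richBad? : Decidable RichBad
    richBad? w = richlyColoured? m w ×-dec bad? w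

    -- With `B` rich bad pairs, `W` is at most `B` plus the good pairs, and `good-bound` limits the
    -- latter by `length Ω * c`. From the resulting inequality the factor `1 + n * n`, the summand
    -- `B` and the factor `c` cancel in turn.
    richBad-bound : ∀ D → (1 + n * n) * (1 + length (vectors (List.allFin l) l) * D) ≤ 2 ^ j →
                    D * length (filter richBad? pairs) ≤ length Ω
    richBad-bound D 2^j≥ = *-cancelˡ-≤ c (+-cancelˡ-≤ B _ _ (*-cancelˡ-≤ (1 + n * n) (begin
      (1 + n * n) * (B + c * (D * B))
        ≡⟨ cong (λ z → (1 + n * n) * (B + z)) (*-assoc c D B) ⟨
      (1 + n * n) * ((1 + c * D) * B)
        ≡⟨ *-assoc (1 + n * n) (1 + c * D) B ⟨
      (1 + n * n) * (1 + c * D) * B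
        ≤⟨ *-mono-≤ 2^j≥ (length-filter-⊆ richBad? bad? (λ {w} → proj₂) pairs) ⟩
      2 ^ j * length (filter bad? pairs) ≤⟨ bad-bound ⟩
      (1 + n * n) * W
        ≤⟨ *-monoʳ-≤ (1 + n * n) (length-filter-∪ (richlyColoured? m) richBad? good?
             (λ {w} → split {w}) pairs) ⟩
      (1 + n * n) * (B + length (filter good? pairs))
        ≤⟨ *-monoʳ-≤ (1 + n * n) (+-monoʳ-≤ B good-bound) ⟩
      (1 + n * n) * (B + length Ω * c)
        ≡⟨ cong (λ z → (1 + n * n) * (B + z)) (*-comm (length Ω) c) ⟩
      (1 + n * n) * (B + c * length Ω) ∎)))
      where
      open ≤-Reasoning
      B = length (filter richBad? pairs)
      c = length (vectors (List.allFin l) l)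
      instance
        c-nonZero : NonZero c
        c-nonZero = Fin.nonZeroIndex (index (vectors-complete ∈-allFin (tabulate {n = l} id)))
      split : ∀ {w} → RichlyColoured m w → RichBad w ⊎ Good w
      split {w} coloured with bad? w
      ... | yes bad = inj₁ (coloured , bad)
      ... | no ¬bad = inj₂ (coloured , ¬bad)

    GoodlyColoured : Structure L n → Set
    GoodlyColoured M = Any (λ γ → Good (M , γ)) (vectors (List.allFin l) n)

    goodlyColoured? : Decidable GoodlyColoured
    goodlyColoured? M = any? (λ γ → good? (M , γ)) (vectors (List.allFin l) n)

    -- A rich colouring of a structure without good colourings is bad, and distinct structures give
    -- distinct pairs.
    notGood-≤-richBad : ∀ {Ms} → Unique (structureSetoid L n) Ms →
      All (λ M → ∃ λ γ → RichlyColoured m (M , γ)) Ms →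
      length (filter (¬? ∘ goodlyColoured?) Ms) ≤ length (filter richBad? pairs)
    notGood-≤-richBad {Ms} u rich = length-≤-cover (structureSetoid L n)
      (UniqueS.filter⁺ (structureSetoid L n) (¬? ∘ goodlyColoured?) u)
      (λ i → proj₁ (List.lookup (filter richBad? pairs) i)) (All.tabulate cover)
      where
      RichBad-resp : RichBad Respects _≈_
      RichBad-resp {x} {y} x≈y@(M≈M′ , refl) ((c , rich) , bad) =
        (IsColouring-resp κ M≈M′ c , rich) , Bad-resp {x} {y} x≈y bad
      cover : ∀ {M} → M ∈ filter (¬? ∘ goodlyColoured?) Ms →
              ∃ λ i → Setoid._≈_ (structureSetoid L n) M (proj₁ (List.lookup (filter richBad? pairs) i))
      cover {M} M∈ = index w∈ , proj₁ (lookup-index w∈)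
        where
        M∈Ms = proj₁ (∈-filter⁻ (¬? ∘ goodlyColoured?) {xs = Ms} M∈)
        γ = proj₁ (All.lookup rich M∈Ms)
        coloured : RichlyColoured m (M , γ)
        coloured = proj₂ (All.lookup rich M∈Ms)
        bad : Bad (M , γ)
        bad = decidable-stable (bad? (M , γ)) λ ¬bad → proj₂ (∈-filter⁻ (¬? ∘ goodlyColoured?) {xs = Ms} M∈)
          (Any.map (λ e → subst (λ γ → Good (M , γ)) e (coloured , ¬bad)) (vectors-complete ∈-allFin γ))
        w∈ = ∈ₛ.∈-filter⁺ pairSetoid richBad? (λ {x} {y} → RichBad-resp {x} {y})
          (pairs-complete M γ (proj₁ coloured)) (coloured , bad)

-- Rational numbers and the logarithm

toℚᵘ-ℕ⇒ℚ : ∀ n → ℚ.toℚᵘ (ℕ⇒ℚ n) ℚᵘ.≃ mkℚᵘ (ℤ.+ n) 0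
toℚᵘ-ℕ⇒ℚ n = ℚ.toℚᵘ-fromℚᵘ (mkℚᵘ (ℤ.+ n) 0)

ℕ⇒ℚ-+ : ∀ m n → ℕ⇒ℚ (m + n) ≡ ℕ⇒ℚ m ℚ.+ ℕ⇒ℚ n
ℕ⇒ℚ-+ m n = ℚ.toℚᵘ-injective (begin
  ℚ.toℚᵘ (ℕ⇒ℚ (m + n))                        ≈⟨ toℚᵘ-ℕ⇒ℚ (m + n) ⟩
  mkℚᵘ (ℤ.+ (m + n)) 0
    ≈⟨ *≡* (cong (ℤ._* ℤ.+ 1) (cong₂ ℤ._+_ (ℤ.*-identityʳ (ℤ.+ m)) (ℤ.*-identityʳ (ℤ.+ n)))) ⟨
  mkℚᵘ (ℤ.+ m) 0 ℚᵘ.+ mkℚᵘ (ℤ.+ n) 0              ≈⟨ ℚᵘ.+-cong (toℚᵘ-ℕ⇒ℚ m) (toℚᵘ-ℕ⇒ℚ n) ⟨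
  ℚ.toℚᵘ (ℕ⇒ℚ m) ℚᵘ.+ ℚ.toℚᵘ (ℕ⇒ℚ n)          ≈⟨ ℚ.toℚᵘ-homo-+ (ℕ⇒ℚ m) (ℕ⇒ℚ n) ⟨
  ℚ.toℚᵘ (ℕ⇒ℚ m ℚ.+ ℕ⇒ℚ n)                    ∎)
  where open ℚᵘ.≃-Reasoning

ℕ⇒ℚ-* : ∀ m n → ℕ⇒ℚ (m * n) ≡ ℕ⇒ℚ m ℚ.* ℕ⇒ℚ n
ℕ⇒ℚ-* m n = ℚ.toℚᵘ-injective (begin
  ℚ.toℚᵘ (ℕ⇒ℚ (m * n))                        ≈⟨ toℚᵘ-ℕ⇒ℚ (m * n) ⟩
  mkℚᵘ (ℤ.+ (m * n)) 0                          ≈⟨ *≡* (cong (ℤ._* ℤ.+ 1) (ℤ.pos-* m n)) ⟩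
  mkℚᵘ (ℤ.+ m) 0 ℚᵘ.* mkℚᵘ (ℤ.+ n) 0              ≈⟨ ℚᵘ.*-cong (toℚᵘ-ℕ⇒ℚ m) (toℚᵘ-ℕ⇒ℚ n) ⟨
  ℚ.toℚᵘ (ℕ⇒ℚ m) ℚᵘ.* ℚ.toℚᵘ (ℕ⇒ℚ n)          ≈⟨ ℚ.toℚᵘ-homo-* (ℕ⇒ℚ m) (ℕ⇒ℚ n) ⟨
  ℚ.toℚᵘ (ℕ⇒ℚ m ℚ.* ℕ⇒ℚ n)                    ∎)
  where open ℚᵘ.≃-Reasoning

ℕ⇒ℚ-mono-≤ : ∀ {m n} → m ≤ n → ℕ⇒ℚ m ℚ.≤ ℕ⇒ℚ n
ℕ⇒ℚ-mono-≤ {m} {n} m≤n = ℚ.toℚᵘ-cancel-≤ (begin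
  ℚ.toℚᵘ (ℕ⇒ℚ m)  ≃⟨ toℚᵘ-ℕ⇒ℚ m ⟩
  mkℚᵘ (ℤ.+ m) 0    ≤⟨ *≤* (ℤ.*-monoʳ-≤-nonNeg (ℤ.+ 1) (ℤ.+≤+ m≤n)) ⟩
  mkℚᵘ (ℤ.+ n) 0    ≃⟨ toℚᵘ-ℕ⇒ℚ n ⟨
  ℚ.toℚᵘ (ℕ⇒ℚ n)  ∎)
  where open ℚᵘ.≤-Reasoning

ℕ⇒ℚ-cancel-< : ∀ {m n} → ℕ⇒ℚ m ℚ.< ℕ⇒ℚ n → m < n
ℕ⇒ℚ-cancel-< m<n = ≰⇒> λ n≤m → ℚ.<-irrefl refl (ℚ.<-≤-trans m<n (ℕ⇒ℚ-mono-≤ n≤m))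

recip-inverse : ∀ n → ℕ⇒ℚ (suc n) ℚ.* recip (suc n) ≡ 1ℚ
recip-inverse n = ℚ.toℚᵘ-injective (begin
  ℚ.toℚᵘ (ℕ⇒ℚ (suc n) ℚ.* recip (suc n))                ≈⟨ ℚ.toℚᵘ-homo-* (ℕ⇒ℚ (suc n)) (recip (suc n)) ⟩
  ℚ.toℚᵘ (ℕ⇒ℚ (suc n)) ℚᵘ.* ℚ.toℚᵘ (recip (suc n))
    ≈⟨ ℚᵘ.*-cong (toℚᵘ-ℕ⇒ℚ (suc n)) (ℚ.toℚᵘ-fromℚᵘ (mkℚᵘ (ℤ.+ 1) n)) ⟩
  mkℚᵘ (ℤ.+ suc n) 0 ℚᵘ.* mkℚᵘ (ℤ.+ 1) n                    ≈⟨ ℚᵘ.*-inverseʳ (mkℚᵘ (ℤ.+ suc n) 0) ⟩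
  ℚᵘ.1ℚᵘ                                                ∎)
  where open ℚᵘ.≃-Reasoning

recip-antitone : ∀ {m n} → m ≤ n → recip (suc n) ℚ.≤ recip (suc m)
recip-antitone {m} {n} m≤n = ℚ.toℚᵘ-cancel-≤ (begin
  ℚ.toℚᵘ (recip (suc n))  ≃⟨ ℚ.toℚᵘ-fromℚᵘ (mkℚᵘ (ℤ.+ 1) n) ⟩
  mkℚᵘ (ℤ.+ 1) n            ≤⟨ *≤* (ℤ.*-monoˡ-≤-nonNeg (ℤ.+ 1) (ℤ.+≤+ (s≤s m≤n))) ⟩
  mkℚᵘ (ℤ.+ 1) m            ≃⟨ ℚ.toℚᵘ-fromℚᵘ (mkℚᵘ (ℤ.+ 1) m) ⟨
  ℚ.toℚᵘ (recip (suc m))  ∎)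
  where open ℚᵘ.≤-Reasoning

-- The denominator of `p` serves as `D`, because the numerator is at least 1.
1≤p*denominator : ∀ p → 0ℚ ℚ.< p → ∃ λ D → 1ℚ ℚ.≤ p ℚ.* ℕ⇒ℚ D
1≤p*denominator p@(mkℚ +[1+ a ] b _) _ = suc b , ℚ.toℚᵘ-cancel-≤ (begin
  ℚᵘ.1ℚᵘ                                   ≤⟨ *≤* (ℤ.+≤+ ineq) ⟩
  ℚ.toℚᵘ p ℚᵘ.* mkℚᵘ (ℤ.+ suc b) 0           ≃⟨ ℚᵘ.*-congˡ {ℚ.toℚᵘ p} (toℚᵘ-ℕ⇒ℚ (suc b)) ⟨
  ℚ.toℚᵘ p ℚᵘ.* ℚ.toℚᵘ (ℕ⇒ℚ (suc b))       ≃⟨ ℚ.toℚᵘ-homo-* p (ℕ⇒ℚ (suc b)) ⟨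
  ℚ.toℚᵘ (p ℚ.* ℕ⇒ℚ (suc b))               ∎)
  where
  open ℚᵘ.≤-Reasoning
  ineq : 1 * (suc b * 1) ≤ suc a * suc b * 1
  ineq = ≤-trans (≤-reflexive (+-identityʳ _)) (*-monoˡ-≤ 1 (m≤n*m (suc b) (suc a)))
1≤p*denominator (mkℚ (ℤ.+ 0) b _)      (*<* (ℤ.+<+ ()))
1≤p*denominator (mkℚ ℤ.-[1+ a ] b _) (*<* ())

-- Harmonic sums and the logarithm.

∑-extend : ∀ a b c g → (∀ i → i < b → c ℚ.≤ g (a + i)) → ∑ a g ℚ.+ ℕ⇒ℚ b ℚ.* c ℚ.≤ ∑ (a + b) g
∑-extend a zero c g c≤ rewrite +-identityʳ a = ℚ.≤-reflexive
  (trans (cong (∑ a g ℚ.+_) (ℚ.*-zeroˡ c)) (ℚ.+-identityʳ _))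
∑-extend a (suc b) c g c≤ rewrite +-suc a b = begin
  ∑ a g ℚ.+ ℕ⇒ℚ (suc b) ℚ.* c              ≡⟨ cong (λ z → ∑ a g ℚ.+ z ℚ.* c) (ℕ⇒ℚ-+ 1 b) ⟩
  ∑ a g ℚ.+ (1ℚ ℚ.+ ℕ⇒ℚ b) ℚ.* c           ≡⟨ rearrange (∑ a g) (ℕ⇒ℚ b) c ⟩
  (∑ a g ℚ.+ ℕ⇒ℚ b ℚ.* c) ℚ.+ c
    ≤⟨ ℚ.+-mono-≤ (∑-extend a b c g (λ i i<b → c≤ i (m<n⇒m<1+n i<b))) (c≤ b (n<1+n b)) ⟩
  ∑ (a + b) g ℚ.+ g (a + b)                ∎
  where
  open ℚ.≤-Reasoning
  rearrange : ∀ x y z → x ℚ.+ (1ℚ ℚ.+ y) ℚ.* z ≡ (x ℚ.+ y ℚ.* z) ℚ.+ z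
  rearrange = solve 3 (λ x y z → x :+ (con 1ℚ :+ y) :* z := (x :+ y :* z) :+ z) refl
    where open +-*-Solver

-- The number of terms in 1/2 + ... + 1/2^k; the recursion exhibits the last dyadic block, of
-- `suc (mersenne k)` terms, in the next such sum.
mersenne : ℕ → ℕ
mersenne zero    = 0
mersenne (suc k) = mersenne k + suc (mersenne k)

suc-mersenne : ∀ k → suc (mersenne k) ≡ 2 ^ k
suc-mersenne zero    = refl
suc-mersenne (suc k) = trans (cong (λ z → z + z) (suc-mersenne k))
  (cong (λ z → 2 ^ k + z) (sym (+-identityʳ (2 ^ k))))

harmonicTerm : ℕ → ℚ
harmonicTerm i = recip (2 + i)

-- The terms 1/(2^k + 1), …, 1/2^(k+1) sum to at least ½.
k≤2∑ : ∀ k → ℕ⇒ℚ k ℚ.≤ ℕ⇒ℚ 2 ℚ.* ∑ (mersenne k) harmonicTerm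
k≤2∑ zero    = ℚ.≤-refl
k≤2∑ (suc k) = begin
  ℕ⇒ℚ (suc k)
    ≡⟨ ℕ⇒ℚ-+ 1 k ⟩
  1ℚ ℚ.+ ℕ⇒ℚ k
    ≤⟨ ℚ.+-monoʳ-≤ 1ℚ (k≤2∑ k) ⟩
  1ℚ ℚ.+ ℕ⇒ℚ 2 ℚ.* ∑ a harmonicTerm
    ≡⟨ cong (ℚ._+ ℕ⇒ℚ 2 ℚ.* ∑ a harmonicTerm) half ⟨
  ℕ⇒ℚ 2 ℚ.* (ℕ⇒ℚ (suc a) ℚ.* c) ℚ.+ ℕ⇒ℚ 2 ℚ.* ∑ a harmonicTerm
    ≡⟨ ℚ.+-comm _ (ℕ⇒ℚ 2 ℚ.* ∑ a harmonicTerm) ⟩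
  ℕ⇒ℚ 2 ℚ.* ∑ a harmonicTerm ℚ.+ ℕ⇒ℚ 2 ℚ.* (ℕ⇒ℚ (suc a) ℚ.* c)
    ≡⟨ ℚ.*-distribˡ-+ (ℕ⇒ℚ 2) (∑ a harmonicTerm) (ℕ⇒ℚ (suc a) ℚ.* c) ⟨
  ℕ⇒ℚ 2 ℚ.* (∑ a harmonicTerm ℚ.+ ℕ⇒ℚ (suc a) ℚ.* c)
    ≤⟨ ℚ.*-monoˡ-≤-nonNeg (ℕ⇒ℚ 2) (∑-extend a (suc a) c harmonicTerm below) ⟩
  ℕ⇒ℚ 2 ℚ.* ∑ (a + suc a) harmonicTerm                                 ∎
  where
  open ℚ.≤-Reasoning
  a = mersenne k
  c = recip (suc a + suc a)
  half : ℕ⇒ℚ 2 ℚ.* (ℕ⇒ℚ (suc a) ℚ.* c) ≡ 1ℚ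
  half = trans (sym (ℚ.*-assoc (ℕ⇒ℚ 2) (ℕ⇒ℚ (suc a)) c))
    (trans (cong (ℚ._* c) (trans (sym (ℕ⇒ℚ-* 2 (suc a))) (cong (λ z → ℕ⇒ℚ (suc a + z)) (+-identityʳ (suc a)))))
      (recip-inverse (a + suc a)))
  below : ∀ i → i < suc a → c ℚ.≤ harmonicTerm (a + i)
  below i (s≤s i≤a) = recip-antitone (≤-trans (s≤s (+-monoʳ-≤ a i≤a)) (≤-reflexive (sym (+-suc a a))))

-- The lower sum for unit intervals is 1/2 + ... + 1/n, which contains the dyadic sum up to 1/2^k.
-- So `ln n` is at least `k / 2`.
k≤2lowerSum : ∀ {k n} → 2 ^ k ≤ n → ℕ⇒ℚ k ℚ.≤ ℕ⇒ℚ 2 ℚ.* lowerSum n 1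
k≤2lowerSum {k} {n} 2^k≤n = begin
  ℕ⇒ℚ k                                                 ≤⟨ k≤2∑ k ⟩
  ℕ⇒ℚ 2 ℚ.* ∑ (mersenne k) harmonicTerm                    ≤⟨ ℚ.*-monoˡ-≤-nonNeg (ℕ⇒ℚ 2) shorter ⟩
  ℕ⇒ℚ 2 ℚ.* lowerSum n 1                                ∎
  where
  open ℚ.≤-Reasoning
  a = mersenne k
  b = (n ∸ 1) * 1 ∸ a
  a≤ : a ≤ (n ∸ 1) * 1
  a≤ = ≤-trans (∸-monoˡ-≤ 1 (≤-trans (≤-reflexive (suc-mersenne k)) 2^k≤n)) (≤-reflexive (sym (*-identityʳ _)))
  shorter : ∑ a harmonicTerm ℚ.≤ lowerSum n 1
  shorter = begin
    ∑ a harmonicTerm                       ≡⟨ ℚ.+-identityʳ _ ⟨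
    ∑ a harmonicTerm ℚ.+ 0ℚ                ≡⟨ cong (∑ a harmonicTerm ℚ.+_) (ℚ.*-zeroʳ (ℕ⇒ℚ b)) ⟨
    ∑ a harmonicTerm ℚ.+ ℕ⇒ℚ b ℚ.* 0ℚ
      ≤⟨ ∑-extend a b 0ℚ harmonicTerm (λ i _ → recip-nonneg (suc (a + i))) ⟩
    ∑ (a + b) harmonicTerm                 ≡⟨ cong (λ z → ∑ z harmonicTerm) (m+[n∸m]≡n a≤) ⟩
    lowerSum n 1                           ∎
    where
    recip-nonneg : ∀ j → 0ℚ ℚ.≤ recip (suc j)
    recip-nonneg j = ℚ.nonNegative⁻¹ _ {{ℚ.normalize-nonNeg 1 (suc j)}}

rich⇒large : ∀ {f} → DominatesLn f → ∀ K → ∃ λ N → ∀ n → N ≤ n → ∀ k → 2 ^ k ≤ n →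
  ∀ {l} (γ : Colouring n l) → Rich (f n) γ → ∀ i → K * k ≤ count (λ a → γ a Fin.≟ i) (allFin n)
rich⇒large {f} dominates K = let (N , above) = dominates P in N , λ n N≤n k 2^k≤n γ rich i →
  ≤-trans (*-monoˡ-≤ k (n≤1+n K)) (<⇒≤ (large n k 2^k≤n (above n N≤n) γ rich i))
  where
  P : ℚ
  -- `suc K` keeps `P` positive also when `K` is 0; the factor 2 compensates for the one in
  -- `k≤2lowerSum`.
  P = ℕ⇒ℚ (suc K * 2)
  instance
    P-pos : ℚ.Positive P
    P-pos = ℚ.normalize-pos (suc K * 2) 1
    P-nonNeg : ℚ.NonNegative P
    P-nonNeg = ℚ.pos⇒nonNeg P
    P-nonZero : ℚ.NonZero P
    P-nonZero = ℚ.pos⇒nonZero P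
    K-nonNeg : ℚ.NonNegative (ℕ⇒ℚ (suc K))
    K-nonNeg = ℚ.normalize-nonNeg (suc K) 1
  large : ∀ n k → 2 ^ k ≤ n → P · ln n <ᴿ f n → ∀ {l} (γ : Colouring n l) → Rich (f n) γ → ∀ i →
          suc K * k < count (λ a → γ a Fin.≟ i) (allFin n)
  large n k 2^k≤n (q , ln-below , f-above) γ rich i = ℕ⇒ℚ-cancel-< (begin-strict
    ℕ⇒ℚ (suc K * k)                                  ≡⟨ ℕ⇒ℚ-* (suc K) k ⟩
    ℕ⇒ℚ (suc K) ℚ.* ℕ⇒ℚ k
      ≤⟨ ℚ.*-monoˡ-≤-nonNeg (ℕ⇒ℚ (suc K)) (k≤2lowerSum {k} 2^k≤n) ⟩
    ℕ⇒ℚ (suc K) ℚ.* (ℕ⇒ℚ 2 ℚ.* lowerSum n 1)         ≡⟨ ℚ.*-assoc (ℕ⇒ℚ (suc K)) (ℕ⇒ℚ 2) (lowerSum n 1) ⟨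
    ℕ⇒ℚ (suc K) ℚ.* ℕ⇒ℚ 2 ℚ.* lowerSum n 1           ≡⟨ cong (ℚ._* lowerSum n 1) (ℕ⇒ℚ-* (suc K) 2) ⟨
    P ℚ.* lowerSum n 1                               ≤⟨ ℚ.*-monoˡ-≤-nonNeg P lowerSum≤ ⟩
    P ℚ.* (1/ P ℚ.* q)                               ≡⟨ ℚ.*-assoc P (1/ P) q ⟨
    P ℚ.* 1/ P ℚ.* q                                 ≡⟨ cong (ℚ._* q) (ℚ.*-inverseʳ P) ⟩
    1ℚ ℚ.* q                                         ≡⟨ ℚ.*-identityˡ q ⟩
    q                                                <⟨ rich i q f-above ⟩
    ℕ⇒ℚ (count (λ a → γ a Fin.≟ i) (allFin n))       ∎)
    where
    open ℚ.≤-Reasoning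
    lowerSum≤ : lowerSum n 1 ℚ.≤ 1/ P ℚ.* q
    -- Otherwise `1/ P * q` would lie in both cuts of `ln n`; the index 0 stands for the partition
    -- into unit intervals.
    lowerSum≤ = ℚ.≮⇒≥ λ below → disjoint (ln n) (1/ P ℚ.* q) ((0 , below) , ln-below)

n<2^n : ∀ n → n < 2 ^ n
n<2^n zero    = s≤s z≤n
n<2^n (suc n) = +-mono-≤ (m^n>0 2 n) (≤-trans (n<2^n n) (≤-reflexive (sym (+-identityʳ (2 ^ n)))))

log₂ : ∀ n .{{_ : NonZero n}} → ∃ λ k → 2 ^ k ≤ n × n < 2 ^ suc k
log₂ (suc zero)    = 0 , s≤s z≤n , s≤s (s≤s z≤n)
log₂ (suc (suc n)) with log₂ (suc n)
... | k , lower , upper with suc (suc n) <? 2 ^ suc k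
...   | yes upper′ = k , m≤n⇒m≤1+n lower , upper′
...   | no ≮       = suc k , ≮⇒≥ ≮ , <-≤-trans (s≤s upper) double
  where
  double : suc (2 ^ suc k) ≤ 2 ^ suc (suc k)
  double = +-mono-≤ (m^n>0 2 (suc k)) (≤-reflexive (sym (+-identityʳ (2 ^ suc k))))

0<½* : ∀ {ε} → 0ℚ ℚ.< ε → 0ℚ ℚ.< ½ ℚ.* ε
0<½* = ℚ.*-monoʳ-<-pos ½

-- One half of `ε` pays for the structures outside the list of rich examples, the other for the `b`
-- exceptions, which are at most a share `1 / D` of `A`.
shrink-proportion : ∀ ε D {A R G b} → 1ℚ ℚ.≤ ½ ℚ.* ε ℚ.* ℕ⇒ℚ D → 0ℚ ℚ.< ε → R ≤ G + b → D * b ≤ A →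
  (1ℚ ℚ.- ½ ℚ.* ε) ℚ.* ℕ⇒ℚ A ℚ.≤ ℕ⇒ℚ R → (1ℚ ℚ.- ε) ℚ.* ℕ⇒ℚ A ℚ.≤ ℕ⇒ℚ G
shrink-proportion ε D {A} {R} {G} {b} 1≤pD 0<ε R≤G+b Db≤A bound =
  ℚ.≮⇒≥ λ G<X → ℚ.<-irrefl refl (ℚ.<-≤-trans (ℚ.+-monoˡ-< (ℕ⇒ℚ b) G<X) (begin
  (1ℚ ℚ.- ε) ℚ.* ℕ⇒ℚ A ℚ.+ ℕ⇒ℚ b                   ≤⟨ ℚ.+-monoʳ-≤ ((1ℚ ℚ.- ε) ℚ.* ℕ⇒ℚ A) b≤pA ⟩
  (1ℚ ℚ.- ε) ℚ.* ℕ⇒ℚ A ℚ.+ p ℚ.* ℕ⇒ℚ A             ≡⟨ split ε (ℕ⇒ℚ A) ⟩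
  (1ℚ ℚ.- p) ℚ.* ℕ⇒ℚ A                             ≤⟨ bound ⟩
  ℕ⇒ℚ R                                            ≤⟨ ℕ⇒ℚ-mono-≤ R≤G+b ⟩
  ℕ⇒ℚ (G + b)                                      ≡⟨ ℕ⇒ℚ-+ G b ⟩
  ℕ⇒ℚ G ℚ.+ ℕ⇒ℚ b                                  ∎))
  where
  open ℚ.≤-Reasoning
  p = ½ ℚ.* ε
  split : ∀ ε A → (1ℚ ℚ.- ε) ℚ.* A ℚ.+ ½ ℚ.* ε ℚ.* A ≡ (1ℚ ℚ.- ½ ℚ.* ε) ℚ.* A
  split = solve 2 (λ ε A → (con 1ℚ :- ε) :* A :+ con ½ :* ε :* A := (con 1ℚ :- con ½ :* ε) :* A) refl
    where open +-*-Solver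
  instance
    p-nonNeg : ℚ.NonNegative p
    p-nonNeg = ℚ.nonNegative (ℚ.<⇒≤ (0<½* 0<ε))
    b-nonNeg : ℚ.NonNegative (ℕ⇒ℚ b)
    b-nonNeg = ℚ.normalize-nonNeg b 1
  b≤pA : ℕ⇒ℚ b ℚ.≤ p ℚ.* ℕ⇒ℚ A
  b≤pA = begin
    ℕ⇒ℚ b                          ≡⟨ ℚ.*-identityˡ (ℕ⇒ℚ b) ⟨
    1ℚ ℚ.* ℕ⇒ℚ b                   ≤⟨ ℚ.*-monoʳ-≤-nonNeg (ℕ⇒ℚ b) 1≤pD ⟩
    p ℚ.* ℕ⇒ℚ D ℚ.* ℕ⇒ℚ b          ≡⟨ ℚ.*-assoc p (ℕ⇒ℚ D) (ℕ⇒ℚ b) ⟩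
    p ℚ.* (ℕ⇒ℚ D ℚ.* ℕ⇒ℚ b)        ≡⟨ cong (p ℚ.*_) (ℕ⇒ℚ-* D b) ⟨
    p ℚ.* ℕ⇒ℚ (D * b)              ≤⟨ ℚ.*-monoˡ-≤-nonNeg p (ℕ⇒ℚ-mono-≤ Db≤A) ⟩
    p ℚ.* ℕ⇒ℚ A                    ∎

-- Asymptotics

count≡length-filter : ∀ {A : Set} {P : A → Set} (P? : Decidable P) {n} (f : Fin n → A) →
  count P? (tabulate f) ≡ length (filter P? (List.tabulate f))
count≡length-filter P? {zero}  f = refl
count≡length-filter P? {suc n} f with ih ← count≡length-filter P? (f ∘ suc) | P? (f zero)
... | yes _ = cong suc ih
... | no _  = ih

count≤length-class : ∀ {n l} {γ γ′ : Colouring n l} → (∀ a → γ a ≡ γ′ a) → ∀ i →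
  count (λ a → γ a Fin.≟ i) (allFin n) ≤ length (class γ′ i)
count≤length-class {γ = γ} γ≗γ′ i = ≤-trans (≤-reflexive (count≡length-filter (λ a → γ a Fin.≟ i) id))
  (length-filter-⊆ (λ a → γ a Fin.≟ i) _ (trans (sym (γ≗γ′ _))) (List.allFin _))

IsColouring-cong : ∀ {L n l} κ {M : Structure L n} {γ γ′ : Colouring n l} → (∀ a → γ a ≡ γ′ a) →
                   IsColouring κ M γ → IsColouring κ M γ′
IsColouring-cong κ γ≗γ′ c = isColouring κ λ R v r → Permitted-refine κ {v = v} {v}
  (λ i j e → trans (γ≗γ′ _) (trans e (sym (γ≗γ′ _)))) (related⇒permitted κ c R v r)

∃^-intro : ∀ {L n k} (M : Structure L n) t (φ : Formula L (t + k)) {ρ : Vec (Fin n) k} us →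
           M ⊨ φ [ us ++ ρ ] → M ⊨ ∃^ t φ [ ρ ]
∃^-intro M zero    φ []       h = h
∃^-intro M (suc t) φ (u ∷ us) h = ∃^-intro M t (∃′ φ) us (u , h)

∃^-elim : ∀ {L n k} (M : Structure L n) t (φ : Formula L (t + k)) {ρ : Vec (Fin n) k} →
          M ⊨ ∃^ t φ [ ρ ] → ∃ λ us → M ⊨ φ [ us ++ ρ ]
∃^-elim M zero    φ h = [] , h
∃^-elim M (suc t) φ h = let (us , u , h′) = ∃^-elim M t (∃′ φ) h in u ∷ us , h′

-- Consequences of rigidity.

module _ {L : Language} {l : ℕ} {κ : Kind} {t n : ℕ} {S : Structure L (t + 2)}
         (forces : ForcesEqualColours κ l S) {M : Structure L n} (rigid : Rigid {L} {t} {κ} {l} {S} M) where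
  open Rigid rigid

  rigid⇒≡ : ∀ {δ : Colouring n l} → IsColouring κ M δ → ∀ {a b} → γ a ≡ γ b → δ a ≡ δ b
  rigid⇒≡ {δ} cδ {a} {b} γa≡γb with a Fin.≟ b
  ... | yes a≡b = cong δ a≡b
  ... | no a≢b  = IsIsomorphism⇒≡ forces (proj₂ (linked a≢b γa≡γb)) cδ

  -- A witness of `ξ` is a copy of 𝒮, which forces equal colours. Conversely, vertices with equal
  -- colours agree under the `γ` of `Rigid` by `separated`, and `linked` supplies the witness.
  rigid⇒definedBy : ∀ {χ} → Characterises χ S → AllColouringsDefinedBy κ l (ξ t χ) M
  rigid⇒definedBy {χ} characterises δ cδ a b = mk⇔ to from
    where
    open Characterises characterises using (correct)
    to : M ⊨ ξ t χ [ a ∷ b ∷ [] ] → δ a ≡ δ b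
    to (inj₁ a≡b) = cong δ a≡b
    to (inj₂ h)   = let (us , χ-holds) = ∃^-elim M t χ h in
      IsIsomorphism⇒≡ forces {us = us} (Equivalence.to (correct M (us ++ a ∷ b ∷ [])) χ-holds) cδ
    from : δ a ≡ δ b → M ⊨ ξ t χ [ a ∷ b ∷ [] ]
    from δa≡δb with a Fin.≟ b
    ... | yes a≡b = inj₁ a≡b
    ... | no a≢b  = let (us , iso) = linked a≢b (separated cδ δa≡δb) in
      inj₂ (∃^-intro M t χ us (Equivalence.from (correct M (us ++ a ∷ b ∷ [])) iso))

  -- The permutation sends a colour to the value of `δ` at a representative of that colour;
  -- `separated` makes it injective.
  rigid⇒unique : UniquelyColourable κ l M
  rigid⇒unique = γ , γ-colours , λ δ cδ →
    let ε = proj₁ ∘ attained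
        γ∘ε = proj₂ ∘ attained
        (π , π≗) = injective⇒permutation {f = δ ∘ ε}
          (λ {i} {j} e → trans (sym (γ∘ε i)) (trans (separated cδ e) (γ∘ε j)))
    in π , λ a → trans (rigid⇒≡ cδ (sym (γ∘ε (γ a)))) (sym (π≗ (γ a)))

proportion-mono : ∀ {L n p} {P Q Q′ : Structure L n → Set} → (∀ {M} → Q M → Q′ M) →
                  ProportionAtLeast p P Q → ProportionAtLeast p P Q′
proportion-mono f pr = record
  { ProportionAtLeast pr
  ; good-sound = All.map (λ (p , q) → p , f q) (ProportionAtLeast.good-sound pr) }

module _ {L : Language} {κ : Kind} {l : ℕ} {f : ℕ → ℝ} (dominates : DominatesLn f)
         (admissible : Admissible κ L l)
         (rich : AlmostAll L κ l (HasRichColouring κ l f))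
         {t : ℕ} {S : Structure L (t + 2)} (forces : ForcesEqualColours κ l S) where

  almostAllRigid : AlmostAll L κ l (Rigid {L} {t} {κ} {l} {S})
  -- From `n ≥ 2` follows `1 ≤ k` for the binary logarithm `k` rounded down, so constants can be
  -- absorbed into multiples of `k`; there is also a vertex `zero` to serve as default.
  almostAllRigid ε 0<ε = 2 ⊔ (N₁ ⊔ N₂) , λ n N≤n → proportion n
      (m⊔n≤o⇒m≤o 2 (N₁ ⊔ N₂) N≤n)
      (above₁ n (m⊔n≤o⇒m≤o N₁ N₂ (m⊔n≤o⇒n≤o 2 (N₁ ⊔ N₂) N≤n)))
      (rich-above n (m⊔n≤o⇒n≤o N₁ N₂ (m⊔n≤o⇒n≤o 2 (N₁ ⊔ N₂) N≤n)))
    where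
    D,1≤ = 1≤p*denominator (½ ℚ.* ε) (0<½* 0<ε)
    D = proj₁ D,1≤
    c = length (vectors (List.allFin l) l)
    C = length (structures L (t + 2)) * t + length (structures L (l + 0)) * l
    -- Chosen as `1 + c * D` itself, so that `n<2^n` gives `1 + c * D ≤ 2 ^ e`.
    e = suc (c * D)
    -- The number `j` of halvings below is at most `(4 + e) * k`, so `K * k` vertices per class are
    -- enough.
    K = (4 + e) * C + 2
    N₁ = proj₁ (rich⇒large {f} dominates K)
    above₁ = proj₂ (rich⇒large {f} dominates K)
    N₂ = proj₁ (rich (½ ℚ.* ε) (0<½* 0<ε))
    rich-above = proj₂ (rich (½ ℚ.* ε) (0<½* 0<ε))

    proportion : ∀ n → 2 ≤ n →
      (∀ k → 2 ^ k ≤ n → ∀ {l} (γ : Colouring n l) → Rich (f n) γ → ∀ i →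
        K * k ≤ count (λ a → γ a Fin.≟ i) (allFin n)) →
      ProportionAtLeast {L} {n} (1ℚ ℚ.- ½ ℚ.* ε) (Colourable κ l) (HasRichColouring κ l f) →
      ProportionAtLeast {L} {n} (1ℚ ℚ.- ε) (Colourable κ l) (Rigid {L} {t} {κ} {l} {S})
    proportion n@(suc _) 2≤n large richProportion = record
      { all = all ; all-unique = all-unique ; all-sound = all-sound ; all-complete = all-complete
      ; good        = filter (goodlyColoured? j fits) good
      ; good-unique = UniqueS.filter⁺ (structureSetoid L n) (goodlyColoured? j fits) good-unique
      ; good-sound  = All.tabulate λ M∈ →
          let (M∈good , goodlyColoured) = ∈-filter⁻ (goodlyColoured? j fits) {xs = good} M∈ in
          proj₁ (All.lookup good-sound M∈good) ,
          let (γ , isGood) = satisfied goodlyColoured in good⇒rigid j fits _ γ isGood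
      ; bound       = shrink-proportion ε D (proj₂ D,1≤) 0<ε few-exceptions (richBad-bound j fits D room) bound
      }
      where
      open ProportionAtLeast {L} {n} richProportion
      open RigidCount {L} {n} {l} {κ} all all-unique all-sound all-complete admissible forces zero
      k = proj₁ (log₂ n)
      2^k≤n = proj₁ (proj₂ (log₂ n))
      n<2^k+1 = proj₂ (proj₂ (log₂ n))
      -- Twice `suc k` halvings outweigh the factor `1 + n * n` of the union bound, and `e` more
      -- outweigh `1 + c * D`.
      j = suc k + suc k + e

      1≤k : 1 ≤ k
      1≤k with k | n<2^k+1
      ... | zero  | n<2 = contradiction 2≤n (<⇒≱ n<2)
      ... | suc _ | _   = s≤s z≤n

      fits : j * C + 2 ≤ K * k
      fits = begin
        j * C + 2                     ≤⟨ +-mono-≤ (*-monoˡ-≤ C j≤) (*-monoʳ-≤ 2 1≤k) ⟩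
        (4 + e) * k * C + 2 * k
          ≡⟨ cong (_+ 2 * k) (trans (*-assoc (4 + e) k C)
               (trans (cong ((4 + e) *_) (*-comm k C)) (sym (*-assoc (4 + e) C k)))) ⟩
        (4 + e) * C * k + 2 * k       ≡⟨ *-distribʳ-+ k ((4 + e) * C) 2 ⟨
        K * k                         ∎
        where
        open ≤-Reasoning
        1+k≤2k : suc k ≤ 2 * k
        1+k≤2k = ≤-trans (+-monoˡ-≤ k 1≤k) (≤-reflexive (cong (k +_) (sym (+-identityʳ k))))
        j≤ : j ≤ (4 + e) * k
        j≤ = begin
          suc k + suc k + e
            ≤⟨ +-mono-≤ (+-mono-≤ 1+k≤2k 1+k≤2k) (≤-trans (≤-reflexive (sym (*-identityʳ e))) (*-monoʳ-≤ e 1≤k)) ⟩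
          2 * k + 2 * k + e * k   ≡⟨ cong (_+ e * k) (*-distribʳ-+ k 2 2) ⟨
          4 * k + e * k           ≡⟨ *-distribʳ-+ k 4 e ⟨
          (4 + e) * k             ∎

      room : (1 + n * n) * (1 + c * D) ≤ 2 ^ j
      room = begin
        (1 + n * n) * (1 + c * D)            ≤⟨ *-mono-≤ square (<⇒≤ (n<2^n e)) ⟩
        2 ^ (suc k + suc k) * 2 ^ e          ≡⟨ ^-distribˡ-+-* 2 (suc k + suc k) e ⟨
        2 ^ j                                ∎
        where
        open ≤-Reasoning
        square : 1 + n * n ≤ 2 ^ (suc k + suc k)
        square = begin
          1 + n * n                ≤⟨ s≤s (≤-trans (*-monoʳ-≤ n (n≤1+n n)) (m≤n+m (n * suc n) n)) ⟩
          suc n * suc n            ≤⟨ *-mono-≤ n<2^k+1 n<2^k+1 ⟩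
          2 ^ suc k * 2 ^ suc k    ≡⟨ ^-distribˡ-+-* 2 (suc k) (suc k) ⟨
          2 ^ (suc k + suc k)      ∎

      richlyColoured : All (λ M → ∃ λ γ → RichlyColoured (K * k) (M , γ)) good
      richlyColoured = All.map (λ (_ , γ , c , γ-rich) → tabulate γ ,
        IsColouring-cong κ (λ a → sym (lookup∘tabulate γ a)) c ,
        λ i → ≤-trans (large k 2^k≤n γ γ-rich i)
          (count≤length-class (λ a → sym (lookup∘tabulate γ a)) i)) good-sound

      few-exceptions : length good ≤ length (filter (goodlyColoured? j fits) good) +
                                     length (filter (richBad? j fits) pairs)
      few-exceptions = ≤-trans (length-≤-filter-¬ (goodlyColoured? j fits) good)
        (+-monoʳ-≤ _ (notGood-≤-richBad j fits good-unique richlyColoured))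

definability : ∀ κ l → 2 ≤ l → ∀ L → Admissible κ L l → ∀ f → DominatesLn f →
  AlmostAll L κ l (HasRichColouring κ l f) →
  (∀ t (S : Structure L (t + 2)) → ForcesEqualColours κ l S → ∀ (χ : Formula L (t + 2)) → Characterises χ S →
    AlmostAll L κ l (AllColouringsDefinedBy κ l (ξ t χ))) ×
  AlmostAll L κ l (UniquelyColourable κ l)
definability κ l@(suc l′) (s≤s 1≤l′) L admissible f dominates rich =
  (λ t S forces χ characterises ε 0<ε →
    let (N , p) = almostAllRigid {f = f} dominates admissible rich forces ε 0<ε in
    N , λ n N≤n → proportion-mono (λ rigid → rigid⇒definedBy forces rigid characterises) (p n N≤n)) ,
  λ ε 0<ε →
    -- Uniqueness involves no given 𝒮, so the explicit instance is used.
    let forces = gadget-forces l′ κ admissible 1≤l′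
        (N , p) = almostAllRigid {f = f} dominates admissible rich forces ε 0<ε in
    N , λ n N≤n → proportion-mono (rigid⇒unique forces) (p n N≤n)

proposition9p20 : (l : ℕ) → 2 ≤ l →
    (L : Language) →
    (f : ℕ → ℝ) → DominatesLn f →
    ( AlmostAll L weak l (HasRichColouring weak l f) →
    ( (∀ t (S : Structure L (t + 2)) → ForcesEqualColours weak l S →
    ∀ (χ : Formula L (t + 2)) → Characterises χ S →
    AlmostAll L weak l (AllColouringsDefinedBy weak l (ξ t χ)))
    × AlmostAll L weak l (UniquelyColourable weak l) ) )
    ×
    ( (∀ R → arity L R ≤ l) →
    AlmostAll L strong l (HasRichColouring strong l f) →
    ( (∀ t (S : Structure L (t + 2)) → ForcesEqualColours strong l S →
    ∀ (χ : Formula L (t + 2)) → Characterises χ S →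
    AlmostAll L strong l (AllColouringsDefinedBy strong l (ξ t χ)))
    × AlmostAll L strong l (UniquelyColourable strong l) ) )
proposition9p20 l 2≤l L f dominates =
  definability weak l 2≤l L tt f dominates ,
  λ arity≤l → definability strong l 2≤l L arity≤l f dominates
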